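{- The $k$-anonymization problem can be solved optimally in polynomial time when both the number of columns $m$ and the alphabet size $|\Sigma|$ are fixed constants. That is, for all fixed positive integers $m$ and $s$ there is a polynomial-time algorithm that, given a table $T$ with $n$ rows and $m$ columns with entries from an alphabet $\Sigma$ of size $s$, and given a privacy parameter $k$ (part of the input) with $k\le n$, outputs a feasible $k$-anonymization solution of $T$ of minimum cost.
   Context: The $k$-anonymization problem. The input is an $n\times m$ table $T$ ($n$ rows, $m$ columns; rows may be repeated) with entries from a finite alphabet $\Sigma$, together with a privacy parameter $k$ (a positive integer). A feasible solution $\sigma$ transforms $T$ into a table $T'$ by suppressing some of the cells of $T$, i.e. replacing the entries of these cells with a symbol $*\notin\Sigma$, so that for every row $t$ of $T'$ there exist at least $k-1$ other rows of $T'$ identical to $t$. The cost of $\sigma$ is the number of suppressed cells. The goal is to find a feasible solution of minimum cost. (A feasible solution exists whenever $n\ge k$, by suppressing all cells.) Equivalently, for a set $S$ of rows of $T$, call a column bad with respect to $S$ if some two rows of $S$ have different values on it, and let $a(S)$ be the number of bad columns. One seeks a partition $\{S_1,\dots,S_\ell\}$ of the rows with $|S_i|\ge k$ for all $i$, minimizing $\sum_{i=1}^{\ell}|S_i|\cdot a(S_i)$. Polynomial time means polynomial in the size of the input. -}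

module Defs where

open import Data.Digit using (toDigits)
open import Data.Fin using (Fin)
open import Data.Fin.Subset using (Subset; Side; inside; outside; ∣_∣; _∈_; _∉_)
open import Data.List as List using (List; []; _∷_; _++_; length; reverse)
open import Data.Maybe using (Maybe; just; nothing)
open import Data.Nat using (ℕ; zero; suc; pred; _+_; _*_; _^_; _≤_)
open import Data.Product using (Σ; ∃-syntax; _×_; _,_; proj₁)
open import Data.Sum using (_⊎_; inj₁; inj₂)
open import Data.Vec as Vec using (Vec; []; _∷_; lookup; toList)
open import Relation.Binary.PropositionalEquality using (_≡_)

------------------------------------------------------------------------
-- Deterministic multi-tape Turing machines

-- Tape symbols: the blank (nothing), the input/output symbols, and w
-- further work symbols.  Instantiate A with finite types only.
Symbol : Set → ℕ → Set
Symbol A w = Maybe (A ⊎ Fin w)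

data Move : Set where
  left stay right : Move

-- Tape zero is both the input and the output tape.  The machine halts
-- when the transition function returns nothing.
record TM (A : Set) : Set where
  field
    states workTapes workSymbols : ℕ
    start : Fin states
    δ     : Fin states → Vec (Symbol A workSymbols) (suc workTapes) →
            Maybe (Fin states ×
                   Vec (Symbol A workSymbols × Move) (suc workTapes))

-- A two-way infinite tape: the scanned cell, the cells to its left
-- (nearest first) and the cells to its right (nearest first).  All cells
-- beyond the two lists are blank.
record Tape (A : Set) (w : ℕ) : Set where
  constructor tape
  field
    before : List (Symbol A w)
    head   : Symbol A w
    after  : List (Symbol A w)

module _ {A : Set} {w : ℕ} where

  moveHead : Move → Tape A w → Tape A w
  moveHead left  (tape []       x rs)       = tape []       nothing (x ∷ rs)
  moveHead left  (tape (l ∷ ls) x rs)       = tape ls       l       (x ∷ rs)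
  moveHead stay  t                          = t
  moveHead right (tape ls       x [])       = tape (x ∷ ls) nothing []
  moveHead right (tape ls       x (r ∷ rs)) = tape (x ∷ ls) r       rs

  writeMove : Symbol A w × Move → Tape A w → Tape A w
  writeMove (y , d) (tape ls _ rs) = moveHead d (tape ls y rs)

  blankTape : Tape A w
  blankTape = tape [] nothing []

  -- The head scans the first symbol of the word.
  inputTape : List A → Tape A w
  inputTape []       = blankTape
  inputTape (a ∷ as) = tape [] (just (inj₁ a)) (List.map (λ b → just (inj₁ b)) as)

  leadingWord : List (Symbol A w) → List A
  leadingWord []                   = []
  leadingWord (nothing       ∷ _)  = []
  leadingWord (just (inj₂ _) ∷ _)  = []
  leadingWord (just (inj₁ a) ∷ xs) = a ∷ leadingWord xs

  -- The maximal word over A that starts at the head and extends rightwards.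
  readTape : Tape A w → List A
  readTape (tape _ x rs) = leadingWord (x ∷ rs)

module _ {A : Set} (M : TM A) where
  open TM M

  record Config : Set where
    constructor config
    field
      state : Fin states
      tapes : Vec (Tape A workSymbols) (suc workTapes)

  initial : List A → Config
  initial u = config start (inputTape u ∷ Vec.replicate workTapes blankTape)

  output : Config → List A
  output (config _ (t ∷ _)) = readTape t

  step : Config → Maybe Config
  step (config q ts) with δ q (Vec.map Tape.head ts)
  ... | nothing        = nothing
  ... | just (q′ , as) = just (config q′ (Vec.zipWith writeMove as ts))

  data HaltsIn : Config → ℕ → Config → Set where
    done : ∀ {c} → step c ≡ nothing → HaltsIn c zero c
    next : ∀ {c c′ d t} → step c ≡ just c′ → HaltsIn c′ t d →
           HaltsIn c (suc t) d

  ComputesWithin : List A → ℕ → List A → Set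
  ComputesWithin u b v =
    ∃[ t ] ∃[ c ] (HaltsIn (initial u) t c × t ≤ b × output c ≡ v)

record SearchProblem (A : Set) : Set₁ where
  field
    Instance       : Set
    Solution       : Instance → Set
    IsCorrect      : (x : Instance) → Solution x → Set
    encodeInstance : Instance → List A
    encodeSolution : (x : Instance) → Solution x → List A

PolynomialTimeSolvable : {A : Set} → SearchProblem A → Set
PolynomialTimeSolvable {A} P =
  Σ (TM A) λ M → ∃[ c ] ∃[ d ] ((x : Instance) →
    let u = encodeInstance x in
    ∃[ y ] (IsCorrect x y ×
            ComputesWithin M u (c * length u ^ d + c) (encodeSolution x y)))
  where open SearchProblem P

------------------------------------------------------------------------
-- k-anonymization

Table : Set → ℕ → ℕ → Set
Table X n m = Vec (Vec X m) n

-- For every row, the set of columns in which its entry is suppressed.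
Suppression : ℕ → ℕ → Set
Suppression n m = Vec (Subset m) n

suppressCell : {X : Set} → Side → X → Maybe X
suppressCell inside  _ = nothing
suppressCell outside x = just x

-- The suppressed entry * is nothing.
suppress : {X : Set} {n m : ℕ} → Suppression n m → Table X n m → Table (Maybe X) n m
suppress = Vec.zipWith (Vec.zipWith suppressCell)

cost : {n m : ℕ} → Suppression n m → ℕ
cost σ = Vec.sum (Vec.map ∣_∣ σ)

IsAnonymous : {X : Set} {n m : ℕ} → ℕ → Table X n m → Set
IsAnonymous {n = n} k T =
  (i : Fin n) → Σ (Subset n) λ S →
    i ∉ S × pred k ≤ ∣ S ∣ × (∀ j → j ∈ S → lookup T j ≡ lookup T i)

IsFeasible : {X : Set} {n m : ℕ} → ℕ → Table X n m → Suppression n m → Set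
IsFeasible k T σ = IsAnonymous k (suppress σ T)

IsOptimal : {X : Set} {n m : ℕ} → ℕ → Table X n m → Suppression n m → Set
IsOptimal k T σ = IsFeasible k T σ × (∀ τ → IsFeasible k T τ → cost σ ≤ cost τ)

record AnonymizationInstance (m s : ℕ) : Set where
  field
    rows         : ℕ
    table        : Table (Fin s) rows m
    privacy      : ℕ
    privacy≥1    : 1 ≤ privacy
    privacy≤rows : privacy ≤ rows

data Letter (s : ℕ) : Set where
  bit   : Fin 2 → Letter s
  entry : Fin s → Letter s
  star  : Letter s

encodeTable : {X : Set} {n m s : ℕ} → (X → Letter s) → Table X n m → List (Letter s)
encodeTable f T = List.map f (toList (Vec.concat T))

encodeMaybe : {s : ℕ} → Maybe (Fin s) → Letter s
encodeMaybe nothing  = star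
encodeMaybe (just x) = entry x

-- toDigits yields the least significant digit first.
encodeBinary : {s : ℕ} → ℕ → List (Letter s)
encodeBinary k = List.map bit (reverse (proj₁ (toDigits 2 k)))

-- The input is k in binary followed by the entries of the table, row by
-- row; the output is the table with suppressed entries, row by row.  Row
-- separators are unnecessary because m is fixed.
kAnonymization : (m s : ℕ) → SearchProblem (Letter s)
kAnonymization m s = record
  { Instance       = AnonymizationInstance m s
  ; Solution       = λ x → Suppression (rows x) m
  ; IsCorrect      = λ x → IsOptimal (privacy x) (table x)
  ; encodeInstance = λ x → encodeBinary (privacy x) ++ encodeTable entry (table x)
  ; encodeSolution = λ x σ → encodeTable encodeMaybe (suppress σ (table x))
  }
  where open AnonymizationInstance

{-# OPTIONS --safe #-}
module Submission where

-- A table has boundedly many kinds of rows, so up to the order of the rows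
-- a suppression is given by the numbers of rows of kind t that receive the
-- suppression pattern S, for the constantly many pairs (t , S).  Starting
-- from the plain table and processing the pairs one after the other, replace
-- the first 0, 1, 2, … plain rows t by their suppressed form, in all possible
-- ways.  This yields polynomially many candidates, each a suppression of the
-- table, and every suppression is a permutation of the rows of some
-- candidate; feasibility and cost do not depend on the order of the rows.
-- It remains to discard the candidates in which some row occurs at least
-- once but fewer than k times and to output one with the fewest stars.
--
-- The algorithm is a structured program on ten stacks.  A tape represents a
-- stack by the word that starts at its head and extends to the right, so the
-- input word is already a stack and the output stack is already an output
-- word.

open import Defs
open import Data.Bool using (Bool; true; false; if_then_else_)
import Data.Bool.Properties as Bool
open import Data.Digit using (fromDigits; toDigits)
open import Data.Fin using (Fin; zero; suc; toℕ; splitAt; _↑ˡ_; _↑ʳ_)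
open import Data.Fin.Properties using (splitAt-↑ˡ; splitAt-↑ʳ)
import Data.Fin.Properties as Fin
open import Data.Fin.Subset as Subset using (Subset; Side; inside; outside; ∣_∣)
open import Data.Fin.Subset.Properties using (p⊂q⇒∣p∣<∣q∣; ∈⊤; ∣⊤∣≡n)
open import Data.List as List using (List; []; _∷_; length; _++_; _ʳ++_)
open import Data.List.Membership.Propositional using (_∈_)
open import Data.List.Membership.Propositional.Properties
  using (∈-cartesianProductWith⁺; ∈-cartesianProduct⁺; ∈-allFin; ∈-map⁺)
open import Data.List.Properties
  using (++-ʳ++; ʳ++-ʳ++; ++-assoc; ++-identityʳ; length-ʳ++; length-replicate;
         reverse-foldl; map-++; length-map; length-++)
import Data.List.Properties as List
open import Data.List.Relation.Binary.Permutation.Propositional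
  using (_↭_; ↭-refl; ↭-sym; ↭-trans; ↭-reflexive; prep; swap)
open import Data.List.Relation.Binary.Permutation.Propositional.Properties
  using (filter-↭; ↭-length; drop-∷; map⁺)
open import Data.List.Relation.Unary.All as All using (All; []; _∷_)
open import Data.List.Relation.Unary.Any using (here; there)
open import Data.Maybe using (Maybe; just; nothing; maybe; is-just)
import Data.Maybe.Properties as Maybe
open import Data.Nat
open import Data.Nat.ListAction as List using (sum)
open import Data.Nat.ListAction.Properties using (sum-↭)
open import Data.Nat.Properties
open import Data.Product using (∃-syntax; _×_; _,_; proj₁; proj₂; map₁)
import Data.Product.Properties as Product
open import Data.Sum using (_⊎_; inj₁; inj₂; [_,_]′)
open import Data.Vec as Vec using (Vec; []; _∷_; lookup; _[_]≔_; _[_]%=_; toList)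
open import Data.Vec.Properties
  using (lookup-map; updateAt-updateAt; updateAt-id; lookup∘updateAt;
         lookup∘updateAt′; []≔-idempotent; []≔-commutes; []≔-lookup; lookup∘update;
         lookup∘update′; length-toList; toList-++; count≤n)
import Data.Vec.Properties as Vec
open import Data.Vec.Relation.Binary.Pointwise.Inductive as Pointwise
  using (Pointwise; []; _∷_)
open import Function using (_∘_)
open import Relation.Binary.Definitions using (DecidableEquality)
open import Relation.Binary.PropositionalEquality
open import Relation.Nullary using (yes; no; does; contradiction)
open import Relation.Nullary.Decidable using (dec-true; dec-false)

-- Structured programs on stacks

-- Each pair multiplies the number of candidates by at most n + 1, since between 0 and n rows are
-- replaced. With (2s)^m pairs, a constant for fixed m and s, the number of candidates is polynomial
-- in n. Which of the plain rows t are replaced is immaterial: they are equal, so the results agree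
-- up to order. A row suppressed with a nonempty pattern contains a star and is never mistaken for a
-- plain row when a later pair is processed. The empty pattern would replace a row by itself, and
-- its pairs are passed over. There are likewise only (s + 1)^m possible rows of a result, so
-- anonymity is tested by counting the occurrences of each of them against k. This is done in unary.
-- Unfolding the binary k is affordable because k is at most n; the same inequality makes the
-- suppression of all cells feasible, so that some candidate always survives.

infixr 5 _⨾_

data Program (A : Set) (n : ℕ) : Set where
  skip     : Program A n
  push     : Fin n → A → Program A n
  pop      : Fin n → Program A n
  copy     : Fin n → Fin n → Program A n
  _⨾_      : Program A n → Program A n → Program A n
  ifTop    : Fin n → (Maybe A → Bool) → Program A n → Program A n → Program A n
  whileTop : Fin n → (Maybe A → Bool) → Program A n → Program A n

module _ {A : Set} {n : ℕ} where

  Store : Set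
  Store = Vec (List A) n

  top : Store → Fin n → Maybe A
  top S i = List.head (lookup S i)

  -- Only loop iterations are charged: a Turing machine runs the
  -- straight-line code between two of them in constant time.
  data Run : Program A n → Store → ℕ → Store → Set where
    skip  : ∀ {S} → Run skip S 0 S
    push  : ∀ {S i a} → Run (push i a) S 0 (S [ i ]%= (a ∷_))
    pop   : ∀ {S i a as} → lookup S i ≡ a ∷ as → Run (pop i) S 0 (S [ i ]≔ as)
    copy  : ∀ {S i j a} → i ≢ j → top S i ≡ just a →
            Run (copy i j) S 0 (S [ j ]%= (a ∷_))
    _⨾_   : ∀ {p q S S′ S″ t u} → Run p S t S′ → Run q S′ u S″ →
            Run (p ⨾ q) S (t + u) S″
    then  : ∀ {i f p q S S′ t} → f (top S i) ≡ true → Run p S t S′ →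
            Run (ifTop i f p q) S t S′
    else  : ∀ {i f p q S S′ t} → f (top S i) ≡ false → Run q S t S′ →
            Run (ifTop i f p q) S t S′
    stop  : ∀ {i f p S} → f (top S i) ≡ false → Run (whileTop i f p) S 0 S
    loop  : ∀ {i f p S S′ S″ t u} → f (top S i) ≡ true → Run p S t S′ →
            Run (whileTop i f p) S′ u S″ → Run (whileTop i f p) S (suc (t + u)) S″
    relax : ∀ {p S S′ t u} → t ≤ u → Run p S t S′ → Run p S u S′

-- Programs as Turing machines

module _ {A : Set} where

  Cell : Set
  Cell = Symbol A 0

  letterOf : Cell → Maybe A
  letterOf nothing         = nothing
  letterOf (just (inj₁ a)) = just a

  -- A stack starts at the head and extends to the right up to the first
  -- blank; what lies to the left of the head is garbage.
  data Holds : List A → Tape A 0 → Set where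
    empty : ∀ {ls rs} → Holds [] (tape ls nothing rs)
    last  : ∀ {a ls} → Holds (a ∷ []) (tape ls (just (inj₁ a)) [])
    cons  : ∀ {a as ls ls′ y rs} → Holds as (tape ls′ y rs) →
            Holds (a ∷ as) (tape ls (just (inj₁ a)) (y ∷ rs))

  holds-anywhere : ∀ {as ls ls′ x rs} → Holds as (tape ls x rs) → Holds as (tape ls′ x rs)
  holds-anywhere empty    = empty
  holds-anywhere last     = last
  holds-anywhere (cons h) = cons h

  holds-input : ∀ u → Holds u (inputTape u)
  holds-input []           = empty
  holds-input (a ∷ [])     = last
  holds-input (a ∷ b ∷ as) = cons (holds-input (b ∷ as))

  holds-read : ∀ {as t} → Holds as t → readTape t ≡ as
  holds-read empty    = refl
  holds-read last     = refl
  holds-read (cons h) = cong (_ ∷_) (holds-read h)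

  holds-letter : ∀ {as t} → Holds as t → letterOf (Tape.head t) ≡ List.head as
  holds-letter empty    = refl
  holds-letter last     = refl
  holds-letter (cons h) = refl

  holds-head : ∀ {as t a} → Holds as t → List.head as ≡ just a → Tape.head t ≡ just (inj₁ a)
  holds-head last     refl = refl
  holds-head (cons h) refl = refl

  -- A push takes two machine steps: moving left uncovers a cell with arbitrary contents, blank or
  -- garbage, and the second step overwrites it. Conversely a pop only moves right and leaves the
  -- popped letter behind as garbage.
  holds-push : ∀ {as t} b → Holds as t →
    Holds (b ∷ as) (writeMove (just (inj₁ b) , stay) (writeMove (Tape.head t , left) t))
  holds-push {t = tape []       x rs} b h = cons h
  holds-push {t = tape (l ∷ ls) x rs} b h = cons h

  holds-pop : ∀ {a as t} → Holds (a ∷ as) t → Holds as (writeMove (Tape.head t , right) t)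
  holds-pop last     = empty
  holds-pop (cons h) = holds-anywhere h

module _ {A : Set} where

  heads : ∀ {n} → Vec (Tape A 0) n → Vec (Cell {A}) n
  heads = Vec.map Tape.head

  idle : ∀ {n} → Vec (Cell {A}) n → Vec (Cell {A} × Move) n
  idle = Vec.map (_, stay)

  act : ∀ {n} → Vec (Cell {A} × Move) n → Vec (Tape A 0) n → Vec (Tape A 0) n
  act = Vec.zipWith writeMove

  act-idle : ∀ {n} (ts : Vec (Tape A 0) n) → act (idle (heads ts)) ts ≡ ts
  act-idle []                = refl
  act-idle (tape _ _ _ ∷ ts) = cong (_ ∷_) (act-idle ts)

  act-edit : ∀ {n} i b (ts : Vec (Tape A 0) n) →
    act (idle (heads ts) [ i ]≔ b) ts ≡ ts [ i ]%= writeMove b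
  act-edit zero    b (t ∷ ts)            = cong (_ ∷_) (act-idle ts)
  act-edit (suc i) b (tape _ _ _ ∷ ts) = cong (_ ∷_) (act-edit i b ts)

  Represents : ∀ {n} → Vec (List A) n → Vec (Tape A 0) n → Set
  Represents = Pointwise Holds

  represents-update : ∀ {n} (i : Fin n) {f g S ts} → Represents S ts →
    (Holds (lookup S i) (lookup ts i) → Holds (f (lookup S i)) (g (lookup ts i))) →
    Represents (S [ i ]%= f) (ts [ i ]%= g)
  represents-update zero    (h ∷ hs) update = update h ∷ hs
  represents-update (suc i) (h ∷ hs) update = h ∷ represents-update i hs update

  represents-letter : ∀ {n} (i : Fin n) {S ts} → Represents S ts →
    letterOf (lookup (heads ts) i) ≡ top S i
  represents-letter zero    (h ∷ hs) = holds-letter h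
  represents-letter (suc i) (h ∷ hs) = represents-letter i hs

module _ {A : Set} {n : ℕ} where

  Tapes Actions : Set
  Tapes   = Vec (Tape A 0) n
  Actions = Vec (Symbol A 0 × Move) n

  -- The number of control states. Even `skip` has one, so that every program has a first state.
  size : Program A n → ℕ
  size skip            = 1
  size (push i a)      = 2
  size (pop i)         = 1
  size (copy i j)      = 2
  size (p ⨾ q)         = size p + size q
  size (ifTop i f p q) = suc (size p + size q)
  size (whileTop i f p) = suc (size p)

  firstState : (p : Program A n) → Fin (size p)
  firstState skip             = zero
  firstState (push i a)       = zero
  firstState (pop i)          = zero
  firstState (copy i j)       = zero
  firstState (p ⨾ q)          = firstState p ↑ˡ size q
  firstState (ifTop i f p q)  = zero
  firstState (whileTop i f p) = zero

  -- The state nothing is the exit of the program.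
  control : (p : Program A n) → Fin (size p) → Vec (Cell {A}) n → Maybe (Fin (size p)) × Actions
  control skip       _    h = nothing , idle h
  control (push i a) zero h = just (suc zero) , idle h [ i ]≔ (lookup h i , left)
  control (push i a) (suc _) h = nothing , idle h [ i ]≔ (just (inj₁ a) , stay)
  control (pop i)    _    h = nothing , idle h [ i ]≔ (lookup h i , right)
  control (copy i j) zero h = just (suc zero) , idle h [ j ]≔ (lookup h j , left)
  control (copy i j) (suc _) h = nothing , idle h [ j ]≔ (lookup h i , stay)
  control (p ⨾ q) x h =
    [ (λ y → map₁ (maybe (just ∘ (_↑ˡ size q)) (just (size p ↑ʳ firstState q))) (control p y h))
    , (λ z → map₁ (maybe (just ∘ (size p ↑ʳ_)) nothing) (control q z h))
    ]′ (splitAt (size p) x)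
  control (ifTop i f p q) zero h =
    just (suc (if f (letterOf (lookup h i)) then firstState p ↑ˡ size q else size p ↑ʳ firstState q)) , idle h
  control (ifTop i f p q) (suc x) h =
    [ (λ y → map₁ (maybe (just ∘ suc ∘ (_↑ˡ size q)) nothing) (control p y h))
    , (λ z → map₁ (maybe (just ∘ suc ∘ (size p ↑ʳ_)) nothing) (control q z h))
    ]′ (splitAt (size p) x)
  control (whileTop i f p) zero h =
    (if f (letterOf (lookup h i)) then just (suc (firstState p)) else nothing) , idle h
  control (whileTop i f p) (suc y) h =
    map₁ (maybe (just ∘ suc) (just zero)) (control p y h)

  data Path (p : Program A n) : Maybe (Fin (size p)) → Tapes → ℕ → Tapes → Set where
    done : ∀ {ts} → Path p nothing ts 0 ts
    advance : ∀ {x ts t ts′} →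
           Path p (proj₁ (control p x (heads ts)))
             (act (proj₂ (control p x (heads ts))) ts) t ts′ →
           Path p (just x) ts (suc t) ts′

  -- Here `f` places the states of `p` among those of `P`, and `e` is the state of `P` to which the
  -- exit of `p` leads. Sequencing, branching and loop bodies are the instances with `e` the first
  -- state of the successor, the exit of `P`, and the loop test.
  path-embed : ∀ {p P} (f : Fin (size p) → Fin (size P)) e →
    (∀ x h → control P (f x) h ≡ map₁ (maybe (just ∘ f) e) (control p x h)) →
    ∀ {x ts ts′ ts″ t u} → Path p x ts t ts′ → Path P e ts′ u ts″ →
    Path P (maybe (just ∘ f) e x) ts (t + u) ts″
  path-embed f e embeds done rest = rest
  path-embed {P = P} f e embeds {ts = ts} {ts″ = ts″} (advance {x} {t = t} path) rest =
    advance (subst (λ r → Path P (proj₁ r) (act (proj₂ r) ts) _ ts″)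
                (sym (embeds x (heads ts)))
                (path-embed f e embeds path rest))

  path-idle : ∀ {p : Program A n} {x ts t ts′} → Path p x ts t ts′ → Path p x (act (idle (heads ts)) ts) t ts′
  path-idle {p} {x} {ts} {t} {ts′} = subst (λ r → Path p x r t ts′) (sym (act-idle ts))

  -- The starts of the `t` loop iterations cut a run into `t + 1` stretches, and within a stretch no
  -- control state is visited twice. Hence the factor `size p`.
  Simulates : Program A n → Store {A} {n} → ℕ → Store {A} {n} → Set
  Simulates p S t S′ = ∀ {ts} → Represents S ts →
    ∃[ u ] ∃[ ts′ ] (Path p (just (firstState p)) ts u ts′ × Represents S′ ts′ × u ≤ suc t * size p)

  push-represents : ∀ i b {S : Store {A} {n}} {ts} → Represents S ts →
    let ts₁ = act (idle (heads ts) [ i ]≔ (lookup (heads ts) i , left)) ts in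
    Represents (S [ i ]%= (b ∷_)) (act (idle (heads ts₁) [ i ]≔ (just (inj₁ b) , stay)) ts₁)
  push-represents i b {S} {ts} hs
    rewrite act-edit i (lookup (heads ts) i , left) ts
          | act-edit i (just (inj₁ b) , stay) (ts [ i ]%= writeMove (lookup (heads ts) i , left))
          | lookup-map i Tape.head ts
          | updateAt-updateAt i {writeMove (just (inj₁ b) , stay)}
              {writeMove (Tape.head (lookup ts i) , left)} ts
    = represents-update i hs (holds-push b)

  pop-represents : ∀ i {S : Store {A} {n}} {ts a as} → lookup S i ≡ a ∷ as → Represents S ts →
    Represents (S [ i ]≔ as) (act (idle (heads ts) [ i ]≔ (lookup (heads ts) i , right)) ts)
  pop-represents i {S} {ts} {a} {as} eq hs
    rewrite act-edit i (lookup (heads ts) i , right) ts | lookup-map i Tape.head ts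
    = represents-update i hs λ h → holds-pop (subst (λ l → Holds l (lookup ts i)) eq h)

  -- In a copy the letter is read only in the second step, after the head of tape `j` has moved;
  -- tape `i` must be a different one to still show it.
  copy-letter : ∀ {i j : Fin n} {S ts} {a : A} b → i ≢ j → top S i ≡ just a → Represents S ts →
    lookup (heads (act (idle (heads ts) [ j ]≔ b) ts)) i ≡ just (inj₁ a)
  copy-letter {i} {j} {S} {ts} b i≢j eq hs
    rewrite act-edit j b ts
          | lookup-map i Tape.head (ts [ j ]%= writeMove b)
          | lookup∘updateAt′ i j {writeMove b} i≢j ts
    = holds-head (Pointwise.lookup hs i) eq

  bound-⨾ : ∀ t u a b {x y} → x ≤ suc t * a → y ≤ suc u * b → x + y ≤ suc (t + u) * (a + b)
  bound-⨾ t u a b {x} {y} x≤ y≤ = begin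
    x + y                                            ≤⟨ +-mono-≤ x≤ y≤ ⟩
    suc t * a + suc u * b                            ≤⟨ +-mono-≤ (*-monoˡ-≤ a (s≤s (m≤m+n t u)))
                                                                 (*-monoˡ-≤ b (s≤s (m≤n+m u t))) ⟩
    suc (t + u) * a + suc (t + u) * b                ≡⟨ *-distribˡ-+ (suc (t + u)) a b ⟨
    suc (t + u) * (a + b)                            ∎
    where open ≤-Reasoning

  bound-loop : ∀ t u a {x y} → x ≤ suc t * a → y ≤ suc u * suc a →
    suc (x + y) ≤ suc (suc (t + u)) * suc a
  bound-loop t u a {x} {y} x≤ y≤ = begin
    suc (x + y)                        ≤⟨ s≤s (+-mono-≤ x≤ y≤) ⟩
    suc (suc t * a + suc u * suc a)    ≤⟨ +-monoˡ-≤ (suc u * suc a) (s≤s (m≤n+m (suc t * a) t)) ⟩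
    suc t + suc t * a + suc u * suc a  ≡⟨ cong (_+ suc u * suc a) (*-suc (suc t) a) ⟨
    suc t * suc a + suc u * suc a      ≡⟨ *-distribʳ-+ (suc a) (suc t) (suc u) ⟨
    (suc t + suc u) * suc a            ≡⟨ cong (λ k → suc k * suc a) (+-suc t u) ⟩
    suc (suc (t + u)) * suc a          ∎
    where open ≤-Reasoning

  simulate : ∀ {p S t S′} → Run p S t S′ → Simulates p S t S′
  simulate skip hs =
    1 , _ , advance done , subst (Represents _) (sym (act-idle _)) hs , s≤s z≤n
  simulate (push {i = i} {a}) hs =
    2 , _ , advance (advance done) , push-represents i a hs , s≤s (s≤s z≤n)
  simulate (pop {i = i} eq) hs =
    1 , _ , advance done , pop-represents i eq hs , s≤s z≤n
  simulate (copy {S} {i} {j} {a} i≢j eq) {ts} hs =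
    2 , _ , advance (advance done) ,
    subst (λ c → Represents _ (act (idle (heads ts₁) [ j ]≔ (c , stay)) ts₁))
          (sym (copy-letter _ i≢j eq hs)) (push-represents j a hs) ,
    s≤s (s≤s z≤n)
    where ts₁ = act (idle (heads ts) [ j ]≔ (lookup (heads ts) j , left)) ts
  simulate (_⨾_ {p} {q} {t = t} {u} run₁ run₂) hs
    with x , ts₁ , path₁ , hs₁ , x≤ ← simulate run₁ hs
    with y , ts₂ , path₂ , hs₂ , y≤ ← simulate run₂ hs₁ =
    x + (y + 0) , ts₂ ,
    path-embed (_↑ˡ size q) (just (size p ↑ʳ firstState q)) first path₁
      (path-embed (size p ↑ʳ_) nothing second path₂ done) ,
    hs₂ , bound-⨾ t u (size p) (size q) x≤ (≤-trans (≤-reflexive (+-identityʳ y)) y≤)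
    where
    first : ∀ x h → control (p ⨾ q) (x ↑ˡ size q) h
                    ≡ map₁ (maybe (just ∘ (_↑ˡ size q)) (just (size p ↑ʳ firstState q))) (control p x h)
    first x h rewrite splitAt-↑ˡ (size p) x (size q) = refl
    second : ∀ x h → control (p ⨾ q) (size p ↑ʳ x) h
                     ≡ map₁ (maybe (just ∘ (size p ↑ʳ_)) nothing) (control q x h)
    second x h rewrite splitAt-↑ʳ (size p) (size q) x = refl
  simulate (then {i} {f} {p} {q} {t = t} eq run) {ts} hs
    with x , ts₁ , path₁ , hs₁ , x≤ ← simulate run hs =
    suc (x + 0) , ts₁ ,
    advance (start (path-idle (path-embed (suc ∘ (_↑ˡ size q)) nothing embeds path₁ done))) , hs₁ ,
    -- The test counts as a program of size 1 without iterations, run before the branch.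
    bound-⨾ 0 t 1 (size p + size q) (s≤s z≤n)
      (≤-trans (≤-reflexive (+-identityʳ x)) (≤-trans x≤ (*-monoʳ-≤ (suc t) (m≤m+n _ (size q)))))
    where
    embeds : ∀ x h → control (ifTop i f p q) (suc (x ↑ˡ size q)) h
                     ≡ map₁ (maybe (just ∘ suc ∘ (_↑ˡ size q)) nothing) (control p x h)
    embeds x h rewrite splitAt-↑ˡ (size p) x (size q) = refl
    start : ∀ {ts₀ u ts₁} → Path (ifTop i f p q) (just (suc (firstState p ↑ˡ size q))) ts₀ u ts₁ →
            Path (ifTop i f p q) (proj₁ (control (ifTop i f p q) zero (heads ts))) ts₀ u ts₁
    start path rewrite represents-letter i hs | eq = path
  simulate (else {i} {f} {p} {q} {t = t} eq run) {ts} hs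
    with x , ts₁ , path₁ , hs₁ , x≤ ← simulate run hs =
    suc (x + 0) , ts₁ ,
    advance (start (path-idle (path-embed (suc ∘ (size p ↑ʳ_)) nothing embeds path₁ done))) , hs₁ ,
    bound-⨾ 0 t 1 (size p + size q) (s≤s z≤n)
      (≤-trans (≤-reflexive (+-identityʳ x)) (≤-trans x≤ (*-monoʳ-≤ (suc t) (m≤n+m _ (size p)))))
    where
    embeds : ∀ x h → control (ifTop i f p q) (suc (size p ↑ʳ x)) h
                     ≡ map₁ (maybe (just ∘ suc ∘ (size p ↑ʳ_)) nothing) (control q x h)
    embeds x h rewrite splitAt-↑ʳ (size p) (size q) x = refl
    start : ∀ {ts₀ u ts₁} → Path (ifTop i f p q) (just (suc (size p ↑ʳ firstState q))) ts₀ u ts₁ →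
            Path (ifTop i f p q) (proj₁ (control (ifTop i f p q) zero (heads ts))) ts₀ u ts₁
    start path rewrite represents-letter i hs | eq = path
  simulate (stop {i} {f} {p} eq) {ts} hs =
    1 , ts , advance (exit (path-idle done)) , hs , s≤s z≤n
    where
    exit : ∀ {ts₀ u ts₁} → Path (whileTop i f p) nothing ts₀ u ts₁ →
           Path (whileTop i f p) (proj₁ (control (whileTop i f p) zero (heads ts))) ts₀ u ts₁
    exit path rewrite represents-letter i hs | eq = path
  simulate (loop {i} {f} {p} {t = t} {u} eq run₁ run₂) {ts} hs
    with x , ts₁ , path₁ , hs₁ , x≤ ← simulate run₁ hs
    with y , ts₂ , path₂ , hs₂ , y≤ ← simulate run₂ hs₁ =
    suc (x + y) , ts₂ ,
    -- The body exits to the test, which is the first state of the loop and thus the start of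
    -- `path₂`.
    advance (start (path-idle (path-embed suc (just zero) (λ _ _ → refl) path₁ path₂))) , hs₂ ,
    bound-loop t u (size p) x≤ y≤
    where
    start : ∀ {ts₀ u ts₁} → Path (whileTop i f p) (just (suc (firstState p))) ts₀ u ts₁ →
            Path (whileTop i f p) (proj₁ (control (whileTop i f p) zero (heads ts))) ts₀ u ts₁
    start path rewrite represents-letter i hs | eq = path
  simulate (relax {p} t≤u run) hs
    with x , ts₁ , path₁ , hs₁ , x≤ ← simulate run hs =
    x , ts₁ , path₁ , hs₁ , ≤-trans x≤ (*-monoˡ-≤ (size p) (s≤s t≤u))

input : ∀ {A n} → List A → Store {A} {suc n}
input u = u ∷ Vec.replicate _ []

module _ {A : Set} {n : ℕ} (p : Program A (suc n)) where

  -- A machine halts without acting, whereas the last transition of a program still acts. An extra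
  -- state zero therefore stands for the exit, and only there does the machine halt.
  resume : Maybe (Fin (size p)) → Fin (suc (size p))
  resume = maybe suc zero

  machine : TM A
  machine = record
    { states      = suc (size p)
    ; workTapes   = n
    ; workSymbols = 0
    ; start       = suc (firstState p)
    ; δ           = λ { zero    h → nothing
                      ; (suc x) h → just (map₁ resume (control p x h)) }
    }

  path-halts : ∀ {x ts t ts′} → Path p x ts t ts′ →
    HaltsIn machine (config (resume x) ts) t (config zero ts′)
  path-halts done        = done refl
  path-halts (advance path) = next refl (path-halts path)

  represents-input : ∀ u → Represents (input u) (inputTape u ∷ Vec.replicate n blankTape)
  represents-input u = holds-input u ∷ blanks n
    where
    blanks : ∀ k → Represents {A} (Vec.replicate k []) (Vec.replicate k blankTape)
    blanks zero    = []
    blanks (suc k) = empty ∷ blanks k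

  machine-computes : ∀ {u t v S} → Run p (input u) t (v ∷ S) →
    ComputesWithin machine u (suc t * size p) v
  machine-computes run with simulate run (represents-input _)
  ... | b , _ ∷ _ , path , h ∷ _ , b≤ = b , _ , path-halts path , b≤ , holds-read h

-- Clearing, filling and moving stacks

module _ {A : Set} {n : ℕ} where

  recast : ∀ {p : Program A n} {S S′ S″ t} → S′ ≡ S″ → Run p S t S′ → Run p S t S″
  recast refl run = run

  clear : Fin n → Program A n
  clear i = whileTop i is-just (pop i)

  transfer : Fin n → Fin n → Program A n
  transfer i j = whileTop i is-just (copy i j ⨾ pop i)

  pushAll : Fin n → List A → Program A n
  pushAll i []       = skip
  pushAll i (a ∷ as) = push i a ⨾ pushAll i as

  -- Unrolled for a number fixed in advance, such as the length of a row, and therefore free of loop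
  -- iterations.
  moveN : ℕ → Fin n → Fin n → Program A n
  moveN zero    i j = skip
  moveN (suc k) i j = copy i j ⨾ pop i ⨾ moveN k i j

  store-unchanged : ∀ {S : Store {A} {n}} {i xs} → lookup S i ≡ xs → S [ i ]≔ xs ≡ S
  store-unchanged {S} {i} refl = []≔-lookup S i

  clear-run : ∀ {i} xs {S : Store {A} {n}} → lookup S i ≡ xs →
    Run (clear i) S (length xs) (S [ i ]≔ [])
  clear-run {i} [] {S} eq =
    subst (Run _ S 0) (sym (store-unchanged eq)) (stop (cong (is-just ∘ List.head) eq))
  clear-run {i} (x ∷ xs) {S} eq =
    loop (cong (is-just ∘ List.head) eq) (pop eq)
      (subst (Run _ _ _) ([]≔-idempotent S i)
        (clear-run xs (lookup∘update i S xs)))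

  pushAll-run : ∀ {i} as {S : Store {A} {n}} → Run (pushAll i as) S 0 (S [ i ]%= (as ʳ++_))
  pushAll-run {i} []       {S} = subst (Run _ S 0) (sym (updateAt-id i S)) skip
  pushAll-run {i} (a ∷ as) {S} =
    push ⨾ subst (Run _ _ _) (updateAt-updateAt i S) (pushAll-run as)

  module _ {i j : Fin n} (i≢j : i ≢ j) where

    unmoved : ∀ {S : Store {A} {n}} → lookup S i ≡ [] → S ≡ S [ i ]≔ [] [ j ]≔ lookup S j
    unmoved {S} eq = begin
      S                              ≡⟨ []≔-lookup S j ⟨
      S [ j ]≔ lookup S j            ≡⟨ cong (_[ j ]≔ lookup S j) (store-unchanged eq) ⟨
      S [ i ]≔ [] [ j ]≔ lookup S j  ∎
      where open ≡-Reasoning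

    moved : ∀ (S : Store {A} {n}) x xs ys zs →
      let S₁ = S [ j ]%= (x ∷_) [ i ]≔ xs in
      S₁ [ i ]≔ zs [ j ]≔ (ys ʳ++ lookup S₁ j) ≡ S [ i ]≔ zs [ j ]≔ (ys ʳ++ (x ∷ lookup S j))
    moved S x xs ys zs = begin
      S₀ [ i ]≔ xs [ i ]≔ zs [ j ]≔ (ys ʳ++ lookup (S₀ [ i ]≔ xs) j)
        ≡⟨ cong₂ (λ S l → S [ j ]≔ (ys ʳ++ l)) ([]≔-idempotent S₀ i)
             (trans (lookup∘update′ (i≢j ∘ sym) S₀ xs) (lookup∘updateAt j S)) ⟩
      S₀ [ i ]≔ zs [ j ]≔ new   ≡⟨ []≔-commutes S₀ i j i≢j ⟩
      S₀ [ j ]≔ new [ i ]≔ zs   ≡⟨ cong (_[ i ]≔ zs) (updateAt-updateAt j S) ⟩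
      S [ j ]≔ new [ i ]≔ zs    ≡⟨ []≔-commutes S i j i≢j ⟨
      S [ i ]≔ zs [ j ]≔ new    ∎
      where
      open ≡-Reasoning
      S₀ = S [ j ]%= (x ∷_)
      new = ys ʳ++ (x ∷ lookup S j)

    lookup-copied : ∀ (S : Store {A} {n}) x → lookup (S [ j ]%= (x ∷_)) i ≡ lookup S i
    lookup-copied S x = lookup∘updateAt′ i j i≢j S

    -- A transfer reverses. Throughout, two reversals in succession restore the order by `ʳ++-ʳ++`.
    transfer-run : ∀ xs {S : Store {A} {n}} → lookup S i ≡ xs →
      Run (transfer i j) S (length xs) (S [ i ]≔ [] [ j ]≔ (xs ʳ++ lookup S j))
    transfer-run [] {S} eq =
      subst (Run _ S 0) (unmoved eq) (stop (cong (is-just ∘ List.head) eq))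
    transfer-run (x ∷ xs) {S} eq =
      loop (cong (is-just ∘ List.head) eq)
        (copy i≢j (cong List.head eq) ⨾ pop (trans (lookup-copied S x) eq))
        (subst (Run _ _ _) (moved S x xs xs [])
          (transfer-run xs (lookup∘update i (S [ j ]%= (x ∷_)) xs)))

    moveN-run : ∀ {k} xs {ys} {S : Store {A} {n}} → length xs ≡ k → lookup S i ≡ xs ++ ys →
      Run (moveN k i j) S 0 (S [ i ]≔ ys [ j ]≔ (xs ʳ++ lookup S j))
    moveN-run [] {ys} {S} refl eq = subst (Run _ S 0) same skip
      where
      same : S ≡ S [ i ]≔ ys [ j ]≔ lookup S j
      same = sym (trans (cong (_[ j ]≔ lookup S j) (store-unchanged eq)) ([]≔-lookup S j))
    moveN-run (x ∷ xs) {ys} {S} refl eq =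
      copy i≢j (cong List.head eq) ⨾ pop (trans (lookup-copied S x) eq) ⨾
      subst (Run _ _ _) (moved S x (xs ++ ys) xs ys)
        (moveN-run xs refl (lookup∘update i (S [ j ]%= (x ∷_)) (xs ++ ys)))

-- Rows of `suc m` cells, tables, and the words that encode them

module Tables (m s : ℕ) where

  Row : Set
  Row = Vec (Maybe (Fin s)) (suc m)

  Rows : ℕ → Set
  Rows n = Vec Row n

  infix 4 _≟ᵣ_

  _≟ᵣ_ : DecidableEquality Row
  _≟ᵣ_ = Vec.≡-dec (Maybe.≡-dec Fin._≟_)

  occurrences : ∀ {n} → Row → Rows n → ℕ
  occurrences o = Vec.count (_≟ᵣ o)

  replaceFirst : ∀ {n} → Row → Row → Rows n → Rows n
  replaceFirst a b []      = []
  replaceFirst a b (r ∷ T) = if does (r ≟ᵣ a) then b ∷ T else r ∷ replaceFirst a b T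

  -- The accumulator mirrors the stack `results`, onto which each variant is pushed before the next
  -- replacement is made.
  variants : ∀ {n} → Row → Row → ℕ → Rows n → List (Rows n) → List (Rows n)
  variants a b zero    T acc = T ∷ acc
  variants a b (suc c) T acc = variants a b c (replaceFirst a b T) (T ∷ acc)

  does-refl : ∀ r → does (r ≟ᵣ r) ≡ true
  does-refl r = dec-true (r ≟ᵣ r) refl

  -- The decrease that ends the rounds of replacement: the inserted `b` does not count as a further
  -- `a`.
  occurrences-replaceFirst : ∀ {n a b c} → a ≢ b → (T : Rows n) →
    occurrences a T ≡ suc c → occurrences a (replaceFirst a b T) ≡ c
  occurrences-replaceFirst {a = a} {b} a≢b (r ∷ T) eq with r ≟ᵣ a
  ... | yes _ rewrite dec-false (b ≟ᵣ a) (a≢b ∘ sym) = suc-injective eq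
  ... | no r≢a rewrite dec-false (r ≟ᵣ a) r≢a = occurrences-replaceFirst a≢b T eq

  L : Set
  L = Letter s

  -- Also the unary digit of all counters and the mark on `flag`.
  token : L
  token = bit zero

  tokens : ℕ → List L
  tokens x = List.replicate x token

  cellOf : Maybe L → Maybe (Maybe (Fin s))
  cellOf nothing          = nothing
  cellOf (just (bit _))   = nothing
  cellOf (just (entry x)) = just (just x)
  cellOf (just star)      = just nothing

  isCell : Maybe L → Bool
  isCell = is-just ∘ cellOf

  isThe : Maybe (Fin s) → Maybe L → Bool
  isThe z l = does (Maybe.≡-dec (Maybe.≡-dec Fin._≟_) (cellOf l) (just z))

  cellOf-encode : ∀ z → cellOf (just (encodeMaybe z)) ≡ just z
  cellOf-encode nothing  = refl
  cellOf-encode (just x) = refl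

  word : List (Maybe (Fin s)) → List L
  word = List.map encodeMaybe

  rowCode : ∀ {k} → Vec (Maybe (Fin s)) k → List L
  rowCode r = word (toList r)

  length-rowCode : ∀ {k} (r : Vec (Maybe (Fin s)) k) → length (rowCode r) ≡ k
  length-rowCode r = trans (length-map encodeMaybe (toList r)) (length-toList r)

  code : ∀ {n} → Rows n → List L
  code = encodeTable encodeMaybe

  code-∷ : ∀ {n} r (T : Rows n) → code (r ∷ T) ≡ rowCode r ++ code T
  code-∷ r T = trans (cong word (toList-++ r (Vec.concat T))) (map-++ encodeMaybe (toList r) _)

  code-∷-++ : ∀ {n} r (T : Rows n) xs → code (r ∷ T) ++ xs ≡ rowCode r ++ code T ++ xs
  code-∷-++ r T xs = trans (cong (_++ xs) (code-∷ r T)) (++-assoc (rowCode r) (code T) xs)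

  code-∷-ʳ++ : ∀ {n} r (T : Rows n) xs → code T ʳ++ (rowCode r ʳ++ xs) ≡ code (r ∷ T) ʳ++ xs
  code-∷-ʳ++ r T xs = sym (trans (cong (_ʳ++ xs) (code-∷ r T)) (++-ʳ++ (rowCode r)))

  length-code : ∀ {n} (T : Rows n) → length (code T) ≡ n * suc m
  length-code T = trans (length-map encodeMaybe (toList (Vec.concat T))) (length-toList (Vec.concat T))

  length-code-ʳ++ : ∀ {n} (T : Rows n) → length (code T ʳ++ []) ≡ n * suc m
  length-code-ʳ++ T = trans (length-ʳ++ (code T)) (trans (+-identityʳ _) (length-code T))

  -- The token serves as a separator, for it does not occur in a table.
  worklist : ∀ {n} → List (Rows n) → List L
  worklist []       = []
  worklist (T ∷ Ts) = token ∷ code T ++ worklist Ts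

  length-worklist : ∀ {n} (Ts : List (Rows n)) → length (worklist Ts) ≡ length Ts * suc (n * suc m)
  length-worklist []       = refl
  length-worklist (T ∷ Ts) =
    cong suc (trans (length-++ (code T)) (cong₂ _+_ (length-code T) (length-worklist Ts)))

  -- Recognizing a given row on top of a stack

  module _ {k : ℕ} where

    -- The continuation `p` starts with the row consumed, `q` with the row intact: each letter
    -- popped on the way adds to the failure branch a push that puts it back. No loop is involved.
    match : ∀ {l} → Fin k → Vec (Maybe (Fin s)) l → Program L k → Program L k → Program L k
    match i []       p q = p
    match i (z ∷ zs) p q = ifTop i (isThe z) (pop i ⨾ match i zs p (push i (encodeMaybe z) ⨾ q)) q

    match-yes : ∀ {l i p q xs S S′ t} (zs : Vec (Maybe (Fin s)) l) → lookup S i ≡ rowCode zs ++ xs →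
      Run p (S [ i ]≔ xs) t S′ → Run (match i zs p q) S t S′
    match-yes {S = S} [] eq run = subst (λ S → Run _ S _ _) (store-unchanged eq) run
    match-yes {i = i} {S = S} (z ∷ zs) eq run =
      then (trans (cong (isThe z ∘ List.head) eq) hit)
        (pop eq ⨾ match-yes zs (lookup∘update i S _)
          (subst (λ S → Run _ S _ _) (sym ([]≔-idempotent S i)) run))
      where
      hit : isThe z (just (encodeMaybe z)) ≡ true
      hit rewrite cellOf-encode z = dec-true (Maybe.≡-dec (Maybe.≡-dec Fin._≟_) (just z) (just z)) refl

    match-no : ∀ {l i p q xs S S′ t} (zs ys : Vec (Maybe (Fin s)) l) → ys ≢ zs →
      lookup S i ≡ rowCode ys ++ xs →
      Run q S t S′ → Run (match i zs p q) S t S′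
    match-no [] [] ys≢zs = contradiction refl ys≢zs
    match-no {i = i} {xs = xs} {S = S} (z ∷ zs) (y ∷ ys) ys≢zs eq run with Maybe.≡-dec Fin._≟_ y z
    ... | no y≢z = else (trans (cong (isThe z ∘ List.head) eq) miss) run
      where
      miss : isThe z (just (encodeMaybe y)) ≡ false
      miss rewrite cellOf-encode y =
        dec-false (Maybe.≡-dec (Maybe.≡-dec Fin._≟_) (just y) (just z)) (y≢z ∘ Maybe.just-injective)
    ... | yes refl =
      then (trans (cong (isThe z ∘ List.head) eq) hit)
        (pop eq ⨾ match-no zs ys (ys≢zs ∘ cong (z ∷_)) (lookup∘update i S _)
          (push ⨾ subst (λ S → Run _ S _ _) (sym restored) run))
      where
      hit : isThe z (just (encodeMaybe z)) ≡ true
      hit rewrite cellOf-encode z = dec-true (Maybe.≡-dec (Maybe.≡-dec Fin._≟_) (just z) (just z)) refl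
      restored : S [ i ]≔ (rowCode ys ++ xs) [ i ]%= (encodeMaybe z ∷_) ≡ S
      restored = trans (updateAt-updateAt i S) (store-unchanged eq)

  -- `work` and `results` hold lists of tables, before and after a pass; `cur` holds the table in
  -- hand, reversed, and `aux` is scratch space. `quota` and `used` share the `k` tokens of the
  -- privacy parameter. `bound` and `spent` share as many tokens as the least cost found so far, and
  -- `best` is a table of that cost. `flag` tells whether a row was replaced.
  work results cur aux quota used bound spent best flag : Fin 10
  work    = zero
  results = suc zero
  cur     = suc (suc zero)
  aux     = suc (suc (suc zero))
  quota   = suc (suc (suc (suc zero)))
  used    = suc (suc (suc (suc (suc zero))))
  bound   = suc (suc (suc (suc (suc (suc zero)))))
  spent   = suc (suc (suc (suc (suc (suc (suc zero))))))
  best    = suc (suc (suc (suc (suc (suc (suc (suc zero)))))))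
  flag    = suc (suc (suc (suc (suc (suc (suc (suc (suc zero))))))))

  P : Set
  P = Program L 10

  store : (w v c a q q′ u u′ r f : List L) → Store {L} {10}
  store w v c a q q′ u u′ r f = w ∷ v ∷ c ∷ a ∷ q ∷ q′ ∷ u ∷ u′ ∷ r ∷ f ∷ []

  load : P
  load = whileTop work isCell (copy work cur ⨾ pop work)

  isCell-worklist : ∀ {n} (Ts : List (Rows n)) → isCell (List.head (worklist Ts)) ≡ false
  isCell-worklist []       = refl
  isCell-worklist (T ∷ Ts) = refl

  isCell-encode : ∀ z → isCell (just (encodeMaybe z)) ≡ true
  isCell-encode z = cong is-just (cellOf-encode z)

  load-run : ∀ {n v c a q q′ u u′ r f} zs (Ts : List (Rows n)) →
    Run load (store (word zs ++ worklist Ts) v c a q q′ u u′ r f) (length zs)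
             (store (worklist Ts) v (word zs ʳ++ c) a q q′ u u′ r f)
  load-run []       Ts = stop (isCell-worklist Ts)
  load-run (z ∷ zs) Ts = loop (isCell-encode z) (copy (λ ()) refl ⨾ pop refl) (load-run zs Ts)

  duplicate : P
  duplicate = whileTop cur is-just (copy cur results ⨾ copy cur aux ⨾ pop cur)

  duplicate-run : ∀ {w v a q q′ u u′ r f} c →
    Run duplicate (store w v c a q q′ u u′ r f) (length c)
                  (store w (c ʳ++ v) [] (c ʳ++ a) q q′ u u′ r f)
  duplicate-run []      = stop refl
  duplicate-run (x ∷ c) =
    loop refl (copy (λ ()) refl ⨾ copy (λ ()) refl ⨾ pop refl) (duplicate-run c)

  sweep : P → P
  sweep p = whileTop work is-just (pop work ⨾ p) ⨾ transfer results aux ⨾ transfer aux work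

  -- Since `p` treats the tables one by one and stacks up its results, the pass as a whole is a left
  -- fold. The two transfers at the end return the results to `work` in unchanged order.
  sweep-run : ∀ {n p q u u′ r} β (f : List (Rows n) → Rows n → List (Rows n)) →
    (∀ T Ts acc → Run p (store (code T ++ worklist Ts) (worklist acc) [] [] q [] u u′ r []) β
                        (store (worklist Ts) (worklist (f acc T)) [] [] q [] u u′ r [])) →
    ∀ Ts → let R = List.foldl f [] Ts in
    Run (sweep p) (store (worklist Ts) [] [] [] q [] u u′ r [])
      (length Ts * suc β + (length R + length R) * suc (n * suc m))
      (store (worklist R) [] [] [] q [] u u′ r [])
  sweep-run {n} {p} {q} {u} {u′} {r} β f body Ts =
    relax (≤-reflexive ticks)
      (each Ts [] ⨾ transfer-run (λ ()) _ refl ⨾ back)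
    where
    open ≡-Reasoning
    R = List.foldl f [] Ts
    ℓ = suc (n * suc m)
    each : ∀ Ts acc →
      Run (whileTop work is-just (pop work ⨾ p))
        (store (worklist Ts) (worklist acc) [] [] q [] u u′ r []) (length Ts * suc β)
        (store [] (worklist (List.foldl f acc Ts)) [] [] q [] u u′ r [])
    each []       acc = stop refl
    each (T ∷ Ts) acc = loop refl (pop refl ⨾ body T Ts acc) (each Ts (f acc T))
    back : Run (transfer aux work) (store [] [] [] (worklist R ʳ++ []) q [] u u′ r [])
             (length (worklist R ʳ++ [])) (store (worklist R) [] [] [] q [] u u′ r [])
    back = recast (cong (λ w → store w [] [] [] q [] u u′ r [])
               (trans (ʳ++-ʳ++ (worklist R) {[]} {[]}) (++-identityʳ (worklist R))))
             (transfer-run (λ ()) (worklist R ʳ++ []) refl)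
    ticks : length Ts * suc β + (length (worklist R) + length (worklist R ʳ++ []))
            ≡ length Ts * suc β + (length R + length R) * ℓ
    ticks = cong (length Ts * suc β +_) (begin
      length (worklist R) + length (worklist R ʳ++ [])
        ≡⟨ cong (length (worklist R) +_) (trans (length-ʳ++ (worklist R)) (+-identityʳ _)) ⟩
      length (worklist R) + length (worklist R)  ≡⟨ cong₂ _+_ (length-worklist R) (length-worklist R) ⟩
      length R * ℓ + length R * ℓ                ≡⟨ *-distribʳ-+ ℓ (length R) (length R) ⟨
      (length R + length R) * ℓ                  ∎)

  -- Iteration counts, with summands in the order of the loops of the programs

  roundTicks : ℕ → ℕ
  roundTicks n = n * suc m + (n + n * suc m)

  expandTicks : ℕ → ℕ
  expandTicks n = n * suc m + suc n * suc (roundTicks n)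

  expandListTicks : ℕ → ℕ → ℕ
  expandListTicks n M = M * suc (expandTicks n) + (suc n * M + suc n * M) * suc (n * suc m)

  checkTicks : ℕ → ℕ → ℕ
  checkTicks n k = n + (n * suc m + k)

  checkListTicks : ℕ → ℕ → ℕ → ℕ
  checkListTicks n k M = M * suc (checkTicks n k) + (M + M) * suc (n * suc m)

  weighTicks : ℕ → ℕ → ℕ
  weighTicks n X = n * suc m + (X + (X + (n * suc m + n * suc m)))

  -- Generating the candidates

  module _ (a b : Row) where

    replaceRow : P
    replaceRow = ifTop flag is-just (moveN (suc m) aux cur)
      (match aux a (pushAll cur (rowCode b) ⨾ push flag token) (moveN (suc m) aux cur))

    replacePass : P
    replacePass = whileTop aux is-just replaceRow

    moveRow : ∀ {n w v c q q′ u u′ r f} x (T : Rows n) →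
      Run (moveN (suc m) aux cur) (store w v c (code (x ∷ T)) q q′ u u′ r f) 0
          (store w v (rowCode x ʳ++ c) (code T) q q′ u u′ r f)
    moveRow {w = w} {v} {c} {q} {q′} {u} {u′} {r} {f} x T =
      moveN-run (λ ()) (rowCode x) {code T} {store w v c (code (x ∷ T)) q q′ u u′ r f} (length-rowCode x) (code-∷ x T)

    replacePass-flagged : ∀ {n w v c q q′ u u′ r} (T : Rows n) →
      Run replacePass (store w v c (code T) q q′ u u′ r (tokens 1)) n
                      (store w v (code T ʳ++ c) [] q q′ u u′ r (tokens 1))
    replacePass-flagged []      = stop refl
    -- Splitting the row exposes its first letter, by which the loop test sees that `aux` is
    -- nonempty.
    replacePass-flagged {w = w} {v} {c} {q} {q′} {u} {u′} {r} (x@(_ ∷ _) ∷ T) =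
      recast (cong (λ c → store w v c [] q q′ u u′ r (tokens 1)) (code-∷-ʳ++ x T c))
        (loop refl (then refl (moveRow x T)) (replacePass-flagged T))

    replacePass-run : ∀ {n w v c q q′ u u′ r} (T : Rows n) →
      Run replacePass (store w v c (code T) q q′ u u′ r []) n
                      (store w v (code (replaceFirst a b T) ʳ++ c) [] q q′ u u′ r (tokens (1 ⊓ occurrences a T)))
    replacePass-run [] = stop refl
    replacePass-run {w = w} {v} {c} {q} {q′} {u} {u′} {r} (x@(_ ∷ _) ∷ T) with x ≟ᵣ a
    ... | yes refl =
      recast (cong (λ c → store w v c [] q q′ u u′ r (tokens 1)) (code-∷-ʳ++ b T c))
        (loop refl
          (else refl (match-yes {S = store w v c (code (x ∷ T)) q q′ u u′ r []} a (code-∷ x T)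
            (pushAll-run (rowCode b) ⨾ push)))
          (replacePass-flagged T))
    ... | no x≢a =
      recast (cong (λ c → store w v c [] q q′ u u′ r (tokens (1 ⊓ occurrences a T)))
          (code-∷-ʳ++ x (replaceFirst a b T) c))
        (loop refl
          (else refl (match-no {S = store w v c (code (x ∷ T)) q q′ u u′ r []} a x x≢a (code-∷ x T) (moveRow x T)))
          (replacePass-run T))

    -- The table in `cur` is added to `results`, and a copy of it with one more row replaced becomes
    -- the new `cur`. If no row `a` was left, `flag` stays empty and the copy, which equals the
    -- table just added, is dropped; thus there is one round more than there are rows `a`.
    round : P
    round = pop flag ⨾ duplicate ⨾ push results token ⨾ replacePass ⨾ ifTop flag is-just skip (clear cur)

    code-restored : ∀ {n} (T : Rows n) xs → (code T ʳ++ []) ʳ++ xs ≡ code T ++ xs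
    code-restored T xs = ʳ++-ʳ++ (code T)

    round-prefix : ∀ {n w acc q q′ u u′ r p t S} (T : Rows n) →
      Run p (store w (worklist (T ∷ acc)) (code (replaceFirst a b T) ʳ++ []) [] q q′ u u′ r
                   (tokens (1 ⊓ occurrences a T))) t S →
      Run (pop flag ⨾ duplicate ⨾ push results token ⨾ replacePass ⨾ p)
          (store w (worklist acc) (code T ʳ++ []) [] q q′ u u′ r (tokens 1))
          (n * suc m + (n + t)) S
    round-prefix {n} {w} {acc} {q} {q′} {u} {u′} {r} T run =
      pop refl ⨾ duplicated ⨾ push ⨾ replacePass-run T ⨾ run
      where
      duplicated : Run duplicate (store w (worklist acc) (code T ʳ++ []) [] q q′ u u′ r []) (n * suc m)
                     (store w (code T ++ worklist acc) [] (code T) q q′ u u′ r [])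
      duplicated =
        recast (cong₂ (λ x y → store w x [] y q q′ u u′ r [])
            (code-restored T (worklist acc)) (trans (code-restored T []) (++-identityʳ (code T))))
          (relax (≤-reflexive (length-code-ʳ++ T)) (duplicate-run (code T ʳ++ [])))

    rounds-run : ∀ {n w acc q q′ u u′ r} → a ≢ b → ∀ c (T : Rows n) → occurrences a T ≡ c →
      Run (whileTop flag is-just round)
        (store w (worklist acc) (code T ʳ++ []) [] q q′ u u′ r (tokens 1))
        (suc c * suc (roundTicks n))
        (store w (worklist (variants a b c T acc)) [] [] q q′ u u′ r [])
    rounds-run {n} {w} {acc} {q} {q′} {u} {u′} {r} a≢b c₀ T eq₀ = go c₀ eq₀
      where
      T′ = replaceFirst a b T
      scanned : ℕ → Store
      scanned c = store w (worklist (T ∷ acc)) (code T′ ʳ++ []) [] q q′ u u′ r (tokens (1 ⊓ c))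
      counted : ∀ {c S} → occurrences a T ≡ c → Run (ifTop flag is-just skip (clear cur)) (scanned c) (n * suc m) S →
        Run (ifTop flag is-just skip (clear cur)) (scanned (occurrences a T)) (n * suc m) S
      counted refl run = run
      go : ∀ c → occurrences a T ≡ c → Run (whileTop flag is-just round)
        (store w (worklist acc) (code T ʳ++ []) [] q q′ u u′ r (tokens 1)) (suc c * suc (roundTicks n))
        (store w (worklist (variants a b c T acc)) [] [] q q′ u u′ r [])
      go zero eq =
        loop refl
          (round-prefix T (counted eq
            (else refl (relax (≤-reflexive (length-code-ʳ++ T′)) (clear-run (code T′ ʳ++ []) refl)))))
          (stop refl)
      go (suc c) eq =
        loop refl
          (round-prefix T (counted eq (then refl (relax z≤n skip))))
          (rounds-run a≢b c T′ (occurrences-replaceFirst a≢b T eq))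

    -- The token on `flag` only lets the first round start; that round emits the table as it is.
    expandTable : P
    expandTable = load ⨾ push flag token ⨾ whileTop flag is-just round

    expandOne : ∀ {n} → List (Rows n) → List (Rows n)
    expandOne = List.foldl (λ acc T → variants a b (occurrences a T) T acc) []

    expandTable-run : ∀ {n acc q q′ u u′ r} → a ≢ b → (T : Rows n) (Ts : List (Rows n)) →
      Run expandTable
        (store (code T ++ worklist Ts) (worklist acc) [] [] q q′ u u′ r []) (expandTicks n)
        (store (worklist Ts) (worklist (variants a b (occurrences a T) T acc)) [] [] q q′ u u′ r [])
    expandTable-run {n} a≢b T Ts =
      relax (≤-reflexive (length-toList (Vec.concat T))) (load-run (toList (Vec.concat T)) Ts) ⨾ push ⨾
      relax (*-monoˡ-≤ (suc (roundTicks n)) (s≤s (count≤n (_≟ᵣ a) T))) (rounds-run a≢b (occurrences a T) T refl)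

    -- If `a` and `b` coincide, replacing would leave the number of rows `a` unchanged, and on a
    -- table containing `a` the rounds would never end. This is the case of the empty suppression
    -- pattern.
    expand : P
    expand with a ≟ᵣ b
    ... | yes _ = skip
    ... | no _  = sweep expandTable

    expandList : ∀ {n} → List (Rows n) → List (Rows n)
    expandList Ts with a ≟ᵣ b
    ... | yes _ = Ts
    ... | no _  = expandOne Ts

    length-variants : ∀ {n} c (T : Rows n) acc → length (variants a b c T acc) ≡ suc c + length acc
    length-variants zero    T acc = refl
    length-variants (suc c) T acc =
      trans (length-variants c (replaceFirst a b T) (T ∷ acc)) (cong suc (+-suc c (length acc)))

    -- A table has one variant for each number of replacements from 0 to the number of rows `a`,
    -- which is at most `n`.
    length-expandOne : ∀ {n} (Ts : List (Rows n)) → length (expandOne Ts) ≤ suc n * length Ts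
    length-expandOne {n} Ts = go Ts [] {0} z≤n
      where
      go : ∀ Ts acc {x} → length acc ≤ x → length (List.foldl (λ acc T → variants a b (occurrences a T) T acc) acc Ts)
                                   ≤ x + suc n * length Ts
      go []       acc {x} acc≤ = ≤-trans acc≤ (m≤m+n x _)
      go (T ∷ Ts) acc {x} acc≤ = ≤-trans
        (go Ts (variants a b (occurrences a T) T acc)
          (≤-trans (≤-reflexive (length-variants (occurrences a T) T acc))
                   (+-mono-≤ (s≤s (count≤n (_≟ᵣ a) T)) acc≤)))
        (≤-reflexive (begin
          suc n + x + suc n * length Ts    ≡⟨ cong (_+ suc n * length Ts) (+-comm (suc n) x) ⟩
          x + suc n + suc n * length Ts    ≡⟨ +-assoc x (suc n) _ ⟩
          x + (suc n + suc n * length Ts)  ≡⟨ cong (x +_) (*-suc (suc n) (length Ts)) ⟨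
          x + suc n * suc (length Ts)      ∎))
        where open ≡-Reasoning

    expand-run : ∀ {n q u u′ r M} (Ts : List (Rows n)) → length Ts ≤ M →
      Run expand (store (worklist Ts) [] [] [] q [] u u′ r []) (expandListTicks n M)
                 (store (worklist (expandList Ts)) [] [] [] q [] u u′ r [])
    expand-run {n} {M = M} Ts Ts≤ with a ≟ᵣ b
    ... | yes _  = relax z≤n skip
    ... | no a≢b = relax
      (+-mono-≤ (*-monoˡ-≤ (suc (expandTicks n)) Ts≤)
                (*-monoˡ-≤ (suc (n * suc m)) (+-mono-≤ out≤ out≤)))
      (sweep-run (expandTicks n) _ (λ T Ts acc → expandTable-run {acc = acc} a≢b T Ts) Ts)
      where
      out≤ : length (expandOne Ts) ≤ suc n * M
      out≤ = ≤-trans (length-expandOne Ts) (*-monoʳ-≤ (suc n) Ts≤)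

    length-expandList : ∀ {n M} (Ts : List (Rows n)) → length Ts ≤ M → length (expandList Ts) ≤ suc n * M
    length-expandList {n} {M} Ts Ts≤ with a ≟ᵣ b
    ... | yes _ = ≤-trans Ts≤ (m≤m+n M (n * M))
    ... | no _  = ≤-trans (length-expandOne Ts) (*-monoʳ-≤ (suc n) Ts≤)

  -- Discarding the candidates that are not anonymous

  -- Having spent one of k tokens for each of c rows, as long as the supply
  -- lasts, one reads off k ≤ c from an empty supply and c = 0 from the absence
  -- of spent tokens; moving the latter back restores the supply.
  spend : Fin 10 → Fin 10 → P
  spend i j = ifTop i is-just (pop i ⨾ push j token) skip

  admissible : ℕ → ℕ → Bool
  admissible k zero    = true
  admissible k (suc c) = does (k ≤? suc c)

  tokens-ʳ++ : ∀ x y → tokens x ʳ++ tokens y ≡ tokens (x + y)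
  tokens-ʳ++ zero    y = refl
  tokens-ʳ++ (suc x) y = trans (tokens-ʳ++ x (suc y)) (cong tokens (+-suc x y))

  length-tokens : ∀ x → length (tokens x) ≡ x
  length-tokens x = length-replicate x

  module _ (o : Row) where

    countRow : P
    countRow = match work o (pushAll cur (rowCode o) ⨾ spend quota used) (moveN (suc m) work cur)

    -- Truncated difference and minimum describe a supply that may run out, after which further
    -- matches spend nothing. Hence the case distinction on `x` at each match.
    countRows-run : ∀ {n l v c a u u′ r f} x y (T : Rows n) (Ts : List (Rows l)) →
      Run (whileTop work isCell countRow)
        (store (code T ++ worklist Ts) v c a (tokens x) (tokens y) u u′ r f) n
        (store (worklist Ts) v (code T ʳ++ c) a
               (tokens (x ∸ occurrences o T)) (tokens ((occurrences o T ⊓ x) + y)) u u′ r f)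
    countRows-run x y [] Ts = stop (isCell-worklist Ts)
    countRows-run {v = v} {c} {a} {u} {u′} {r} {f} x y (z@(z₀ ∷ _) ∷ T) Ts with z ≟ᵣ o
    ... | no z≢o =
      recast (cong (λ c → store (worklist Ts) v c a (tokens (x ∸ occurrences o T))
                                (tokens ((occurrences o T ⊓ x) + y)) u u′ r f) (code-∷-ʳ++ z T c))
        (loop (isCell-encode z₀)
          (match-no {S = S} o z z≢o (code-∷-++ z T (worklist Ts))
            (moveN-run (λ ()) (rowCode z) {code T ++ worklist Ts} {S} (length-rowCode z) (code-∷-++ z T (worklist Ts))))
          (countRows-run x y T Ts))
      where S = store (code (z ∷ T) ++ worklist Ts) v c a (tokens x) (tokens y) u u′ r f
    countRows-run {v = v} {c} {a} {u} {u′} {r} {f} zero y (z@(z₀ ∷ _) ∷ T) Ts | yes refl =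
      recast (cong₂ (λ c x → store (worklist Ts) v c a x (tokens y) u u′ r f)
               (code-∷-ʳ++ z T c) (cong tokens (0∸n≡0 (occurrences o T))))
        (loop (isCell-encode z₀)
          (match-yes {S = S} o (code-∷-++ z T (worklist Ts)) (pushAll-run (rowCode o) ⨾ else refl skip))
          (recast (cong (λ e → store (worklist Ts) v (code T ʳ++ (rowCode z ʳ++ c)) a
                                     (tokens (0 ∸ occurrences o T)) (tokens (e + y)) u u′ r f)
                    (⊓-zeroʳ (occurrences o T)))
            (countRows-run zero y T Ts)))
      where S = store (code (z ∷ T) ++ worklist Ts) v c a [] (tokens y) u u′ r f
    countRows-run {v = v} {c} {a} {u} {u′} {r} {f} (suc x) y (z@(z₀ ∷ _) ∷ T) Ts | yes refl =
      recast (cong₂ (λ c e → store (worklist Ts) v c a (tokens (x ∸ occurrences o T)) (tokens e) u u′ r f)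
               (code-∷-ʳ++ z T c) (+-suc (occurrences o T ⊓ x) y))
        (loop (isCell-encode z₀)
          (match-yes {S = S} o (code-∷-++ z T (worklist Ts)) (pushAll-run (rowCode o) ⨾ then refl (pop refl ⨾ push)))
          (countRows-run x (suc y) T Ts))
      where S = store (code (z ∷ T) ++ worklist Ts) v c a (tokens (suc x)) (tokens y) u u′ r f

    emit discard : P
    emit    = transfer cur results ⨾ push results token
    discard = clear cur

    decide : P
    decide = ifTop used is-just (ifTop quota is-just discard emit) emit

    checkTable : P
    checkTable = whileTop work isCell countRow ⨾ decide ⨾ transfer used quota

    keep : ∀ {n} → ℕ → List (Rows n) → Rows n → List (Rows n)
    keep k acc T = if admissible k (occurrences o T) then T ∷ acc else acc

    emit-run : ∀ {n w acc a q q′ u u′ r f} (T : Rows n) →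
      Run emit (store w (worklist acc) (code T ʳ++ []) a q q′ u u′ r f) (n * suc m)
               (store w (worklist (T ∷ acc)) [] a q q′ u u′ r f)
    emit-run {n} {w} {acc} {a} {q} {q′} {u} {u′} {r} {f} T =
      recast (cong (λ v → store w (token ∷ v) [] a q q′ u u′ r f) (ʳ++-ʳ++ (code T)))
        (relax (≤-reflexive (trans (+-identityʳ _) (length-code-ʳ++ T)))
          (transfer-run (λ ()) (code T ʳ++ []) refl ⨾ push))

    decide-run : ∀ {n w acc u u′ r f} k c → 1 ≤ k → (T : Rows n) →
      Run decide
        (store w (worklist acc) (code T ʳ++ []) [] (tokens (k ∸ c)) (tokens ((c ⊓ k) + 0)) u u′ r f)
        (n * suc m)
        (store w (worklist (if admissible k c then T ∷ acc else acc)) [] []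
               (tokens (k ∸ c)) (tokens ((c ⊓ k) + 0)) u u′ r f)
    decide-run {acc = acc} k zero 1≤k T = else refl (emit-run {acc = acc} T)
    decide-run {acc = acc} (suc k) (suc c) 1≤k T with suc k ≤? suc c
    ... | yes k≤c rewrite dec-true (suc k ≤? suc c) k≤c | m≤n⇒m∸n≡0 (s≤s⁻¹ k≤c) =
      then refl (else refl (emit-run {acc = acc} T))
    ... | no k≰c rewrite dec-false (suc k ≤? suc c) k≰c with k ∸ c | m<n⇒0<n∸m (s≤s⁻¹ (≰⇒> k≰c))
    ...   | suc _ | _ =
      then refl (then refl (relax (≤-reflexive (length-code-ʳ++ T)) (clear-run (code T ʳ++ []) refl)))

    checkTable-run : ∀ {n acc u u′ r} k → 1 ≤ k → (T : Rows n) (Ts : List (Rows n)) →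
      Run checkTable
        (store (code T ++ worklist Ts) (worklist acc) [] [] (tokens k) [] u u′ r []) (checkTicks n k)
        (store (worklist Ts) (worklist (keep k acc T)) [] [] (tokens k) [] u u′ r [])
    checkTable-run {n} {acc} {u} {u′} {r} k 1≤k T Ts =
      recast (cong (λ q → store (worklist Ts) (worklist (keep k acc T)) [] [] q [] u u′ r []) restored)
        (countRows-run k 0 T Ts ⨾ decide-run {acc = acc} k c 1≤k T ⨾
          relax used≤k (transfer-run (λ ()) (tokens ((c ⊓ k) + 0)) refl))
      where
      c = occurrences o T
      restored : tokens ((c ⊓ k) + 0) ʳ++ tokens (k ∸ c) ≡ tokens k
      restored = trans (tokens-ʳ++ ((c ⊓ k) + 0) (k ∸ c)) (cong tokens (begin
        (c ⊓ k) + 0 + (k ∸ c)  ≡⟨ cong (_+ (k ∸ c)) (+-identityʳ (c ⊓ k)) ⟩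
        (c ⊓ k) + (k ∸ c)      ≡⟨ m⊓n+n∸m≡n c k ⟩
        k                      ∎))
        where open ≡-Reasoning
      used≤k : length (tokens ((c ⊓ k) + 0)) ≤ k
      used≤k = ≤-trans (≤-reflexive (trans (length-tokens ((c ⊓ k) + 0)) (+-identityʳ (c ⊓ k)))) (m⊓n≤n c k)

    check : P
    check = sweep checkTable

    checkList : ∀ {n} → ℕ → List (Rows n) → List (Rows n)
    checkList k = List.foldl (keep k) []

    length-checkList : ∀ {n M} k (Ts : List (Rows n)) → length Ts ≤ M → length (checkList k Ts) ≤ M
    length-checkList k Ts = ≤-trans (go Ts [])
      where
      go : ∀ Ts acc → length (List.foldl (keep k) acc Ts) ≤ length acc + length Ts
      go []       acc = ≤-reflexive (sym (+-identityʳ _))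
      go (T ∷ Ts) acc = ≤-trans (go Ts (keep k acc T)) (≤-trans (+-monoˡ-≤ (length Ts) kept)
                          (≤-reflexive (sym (+-suc (length acc) (length Ts)))))
        where
        kept : length (keep k acc T) ≤ suc (length acc)
        kept with admissible k (occurrences o T)
        ... | true  = ≤-refl
        ... | false = n≤1+n _

    check-run : ∀ {n k u u′ r M} → 1 ≤ k → (Ts : List (Rows n)) → length Ts ≤ M →
      Run check (store (worklist Ts) [] [] [] (tokens k) [] u u′ r []) (checkListTicks n k M)
                (store (worklist (checkList k Ts)) [] [] [] (tokens k) [] u u′ r [])
    check-run {n} {k} {M = M} 1≤k Ts Ts≤ = relax
      (+-mono-≤ (*-monoˡ-≤ (suc (checkTicks n k)) Ts≤)
                (*-monoˡ-≤ (suc (n * suc m)) (+-mono-≤ out≤ out≤)))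
      (sweep-run (checkTicks n k) (keep k) (λ T Ts acc → checkTable-run {acc = acc} k 1≤k T Ts) Ts)
      where
      out≤ : length (checkList k Ts) ≤ M
      out≤ = length-checkList k Ts Ts≤

  -- Minimizing the number of stars

  stars : List (Maybe (Fin s)) → ℕ
  stars []             = 0
  stars (nothing ∷ zs) = suc (stars zs)
  stars (just _ ∷ zs)  = stars zs

  weight : ∀ {n} → Rows n → ℕ
  weight T = stars (toList (Vec.concat T))

  isStar : Maybe L → Bool
  isStar (just star) = true
  isStar _           = false

  weighLetter : P
  weighLetter = ifTop work isStar (spend bound spent) skip ⨾ copy work cur ⨾ pop work

  weigh-run : ∀ {n v c a q q′ r f} x y zs (Ts : List (Rows n)) →
    Run (whileTop work isCell weighLetter)
      (store (word zs ++ worklist Ts) v c a q q′ (tokens x) (tokens y) r f) (length zs)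
      (store (worklist Ts) v (word zs ʳ++ c) a q q′ (tokens (x ∸ stars zs)) (tokens ((stars zs ⊓ x) + y)) r f)
  weigh-run x y [] Ts = stop (isCell-worklist Ts)
  weigh-run x y (just z ∷ zs) Ts =
    loop refl (else refl skip ⨾ copy (λ ()) refl ⨾ pop refl) (weigh-run x y zs Ts)
  weigh-run {v = v} {c} {a} {q} {q′} {r} {f} zero y (nothing ∷ zs) Ts =
    recast (cong₂ (λ x e → store (worklist Ts) v (word zs ʳ++ (star ∷ c)) a q q′ (tokens x) (tokens (e + y)) r f)
             (0∸n≡0 (stars zs)) (⊓-zeroʳ (stars zs)))
      (loop refl (then refl (else refl skip) ⨾ copy (λ ()) refl ⨾ pop refl) (weigh-run zero y zs Ts))
  weigh-run {v = v} {c} {a} {q} {q′} {r} {f} (suc x) y (nothing ∷ zs) Ts =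
    recast (cong (λ e → store (worklist Ts) v (word zs ʳ++ (star ∷ c)) a q q′ (tokens (x ∸ stars zs)) (tokens e) r f)
             (+-suc (stars zs ⊓ x) y))
      (loop refl (then refl (then refl (pop refl ⨾ push)) ⨾ copy (λ ()) refl ⨾ pop refl) (weigh-run x (suc y) zs Ts))

  -- One token of `bound` is spent for each star. A token is left exactly when the table is cheaper
  -- than the best so far; the spent tokens then number its weight and become the new bound.
  -- Otherwise all tokens were spent, and moving them back restores the old bound.
  improve reject weighTable minimize : P
  improve    = clear bound ⨾ transfer spent bound ⨾ clear best ⨾ transfer cur best
  reject     = clear cur ⨾ transfer spent bound
  weighTable = whileTop work isCell weighLetter ⨾ ifTop bound is-just improve reject
  minimize   = whileTop work is-just (pop work ⨾ weighTable)

  weighTable-improve : ∀ {n q q′ x r X} (T : Rows n) (Ts : List (Rows n)) → weight T < x →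
    x ≤ X → length r ≤ n * suc m →
    Run weighTable (store (code T ++ worklist Ts) [] [] [] q q′ (tokens x) [] r []) (weighTicks n X)
                   (store (worklist Ts) [] [] [] q q′ (tokens (weight T)) [] (code T) [])
  weighTable-improve {n} {q} {q′} {x} {r} {X} T Ts w<x x≤X r≤ =
    relax (≤-reflexive (length-toList (Vec.concat T))) (weigh-run x 0 (toList (Vec.concat T)) Ts) ⨾
    then positive
      (recast (cong₂ (λ u r → store (worklist Ts) [] [] [] q q′ u [] r [])
                (trans (tokens-ʳ++ y 0) (cong tokens (trans (+-identityʳ y) y≡w)))
                (trans (ʳ++-ʳ++ (code T)) (++-identityʳ (code T))))
        (relax (≤-trans (length≤ (x ∸ w)) (≤-trans (m∸n≤m x w) x≤X)) (clear-run (tokens (x ∸ w)) refl) ⨾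
         relax (≤-trans (length≤ y) (≤-trans (≤-reflexive y≡w) (≤-trans (<⇒≤ w<x) x≤X)))
           (transfer-run (λ ()) (tokens y) refl) ⨾
         relax r≤ (clear-run r refl) ⨾
         relax (≤-reflexive (length-code-ʳ++ T)) (transfer-run (λ ()) (code T ʳ++ []) refl)))
    where
    w = weight T
    y = (w ⊓ x) + 0
    length≤ : ∀ y → length (tokens y) ≤ y
    length≤ y = ≤-reflexive (length-tokens y)
    y≡w : y ≡ w
    y≡w = trans (+-identityʳ _) (m≤n⇒m⊓n≡m (<⇒≤ w<x))
    positive : is-just (List.head (tokens (x ∸ w))) ≡ true
    positive with x ∸ w | m<n⇒0<n∸m w<x
    ... | suc _ | _ = refl

  weighTable-reject : ∀ {n q q′ x r X} (T : Rows n) (Ts : List (Rows n)) → x ≤ weight T → x ≤ X →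
    Run weighTable (store (code T ++ worklist Ts) [] [] [] q q′ (tokens x) [] r []) (weighTicks n X)
                   (store (worklist Ts) [] [] [] q q′ (tokens x) [] r [])
  weighTable-reject {n} {q} {q′} {x} {r} {X} T Ts x≤w x≤X =
    recast (cong (λ u → store (worklist Ts) [] [] [] q q′ u [] r []) restored)
      (relax (≤-reflexive (length-toList (Vec.concat T))) (weigh-run x 0 (toList (Vec.concat T)) Ts) ⨾
       else (cong (is-just ∘ List.head ∘ tokens) (m≤n⇒m∸n≡0 x≤w))
         (relax ticks
           (relax (≤-reflexive (length-code-ʳ++ T)) (clear-run (code T ʳ++ []) refl) ⨾
            relax (≤-trans (≤-reflexive (trans (length-tokens y) y≡x)) x≤X) (transfer-run (λ ()) (tokens y) refl))))
    where
    w = weight T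
    y = (w ⊓ x) + 0
    y≡x : y ≡ x
    y≡x = trans (+-identityʳ _) (m≥n⇒m⊓n≡n x≤w)
    restored : tokens y ʳ++ tokens (x ∸ w) ≡ tokens x
    restored = trans (tokens-ʳ++ y (x ∸ w))
      (cong tokens (trans (cong₂ _+_ y≡x (m≤n⇒m∸n≡0 x≤w)) (+-identityʳ x)))
    ticks : n * suc m + X ≤ X + (X + (n * suc m + n * suc m))
    ticks = ≤-trans (≤-reflexive (+-comm (n * suc m) X)) (+-monoʳ-≤ X
              (≤-trans (m≤m+n _ (n * suc m)) (m≤n+m _ X)))

  -- The bound `x` shrinks during the search, while `X` stays the same and gives all tables a common
  -- time bound. The first alternative of `origin` is the search that never improved.
  record Minimized {n} (Ts : List (Rows n)) (x : ℕ) (r : List L) (q q′ : List L) (X : ℕ) : Set where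
    field
      x′      : ℕ
      r′      : List L
      run     : Run minimize (store (worklist Ts) [] [] [] q q′ (tokens x) [] r [])
                  (length Ts * suc (weighTicks n X))
                  (store [] [] [] [] q q′ (tokens x′) [] r′ [])
      x′≤x    : x′ ≤ x
      minimal : ∀ {T} → T ∈ Ts → x′ ≤ weight T
      origin  : (x′ ≡ x × r′ ≡ r) ⊎ (∃[ T ] (T ∈ Ts × x′ ≡ weight T × r′ ≡ code T))

  minimize-run : ∀ {n q q′ X} (Ts : List (Rows n)) x r → x ≤ X → length r ≤ n * suc m →
    Minimized Ts x r q q′ X
  minimize-run [] x r x≤X r≤ = record
    { x′ = x ; r′ = r ; run = stop refl ; x′≤x = ≤-refl ; minimal = λ () ; origin = inj₁ (refl , refl) }
  minimize-run (T ∷ Ts) x r x≤X r≤ with weight T <? x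
  ... | yes w<x = record
    { x′ = M.x′ ; r′ = M.r′
    ; run = loop refl (pop refl ⨾ weighTable-improve T Ts w<x x≤X r≤) M.run
    ; x′≤x = ≤-trans M.x′≤x (<⇒≤ w<x)
    ; minimal = λ { (here refl) → M.x′≤x ; (there T∈) → M.minimal T∈ }
    ; origin = inj₂ ([ (λ { (x≡ , r≡) → T , here refl , x≡ , r≡ })
                     , (λ { (U , U∈ , x≡ , r≡) → U , there U∈ , x≡ , r≡ }) ]′ M.origin)
    }
    where module M = Minimized (minimize-run Ts (weight T) (code T) (≤-trans (<⇒≤ w<x) x≤X)
                                 (≤-reflexive (length-code T)))
  ... | no w≮x = record
    { x′ = M.x′ ; r′ = M.r′
    ; run = loop refl (pop refl ⨾ weighTable-reject T Ts (≮⇒≥ w≮x) x≤X) M.run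
    ; x′≤x = M.x′≤x
    ; minimal = λ { (here refl) → ≤-trans M.x′≤x (≮⇒≥ w≮x) ; (there T∈) → M.minimal T∈ }
    ; origin = [ inj₁ , (λ { (U , U∈ , x≡ , r≡) → inj₂ (U , there U∈ , x≡ , r≡) }) ]′ M.origin
    }
    where module M = Minimized (minimize-run Ts x r x≤X r≤)

  -- The complete program

  isBit isOne : Maybe L → Bool
  isBit (just (bit _)) = true
  isBit _              = false
  isOne (just (bit (suc zero))) = true
  isOne _                       = false

  double readBits : P
  double   = whileTop quota is-just (pop quota ⨾ push used token ⨾ push used token)
  readBits = whileTop work isBit
    (double ⨾ transfer used quota ⨾ ifTop work isOne (push quota token) skip ⨾ pop work)

  -- The input lists the most significant bit first, so the value is built up from the left; the
  -- summands are arranged as in `fromDigits`.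
  horner : ℕ → List (Fin 2) → ℕ
  horner = List.foldl (λ x d → toℕ d + x * 2)

  -- Intermediate values never exceed the final one, so each bit costs at most `k + k` inner
  -- iterations.
  x≤horner : ∀ x ds → x ≤ horner x ds
  x≤horner x []       = ≤-refl
  x≤horner x (d ∷ ds) = ≤-trans (≤-trans (m≤m*n x 2) (m≤n+m (x * 2) (toℕ d))) (x≤horner _ ds)

  horner-reverse : ∀ ds → horner 0 (List.reverse ds) ≡ fromDigits ds
  horner-reverse ds = trans (reverse-foldl _ 0 ds) (go ds)
    where
    go : ∀ ds → List.foldr (λ d x → toℕ d + x * 2) 0 ds ≡ fromDigits ds
    go []       = refl
    go (d ∷ ds) = cong (λ x → toℕ d + x * 2) (go ds)

  double-run : ∀ {w v c a u u′ r f} x y →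
    Run double (store w v c a (tokens x) (tokens y) u u′ r f) x
               (store w v c a [] (tokens (x * 2 + y)) u u′ r f)
  double-run zero y = stop refl
  double-run {w} {v} {c} {a} {u} {u′} {r} {f} (suc x) y =
    recast (cong (λ e → store w v c a [] (tokens e) u u′ r f)
             (trans (+-suc (x * 2) (suc y)) (cong suc (+-suc (x * 2) y))))
      (loop refl (pop refl ⨾ push ⨾ push) (double-run x (suc (suc y))))

  isBit-word : ∀ zs → isBit (List.head (word zs)) ≡ false
  isBit-word []             = refl
  isBit-word (nothing ∷ zs) = refl
  isBit-word (just _ ∷ zs)  = refl

  readBits-run : ∀ {v c a u u′ r f k} x ds zs → horner x ds ≤ k →
    Run readBits (store (List.map bit ds ++ word zs) v c a (tokens x) [] u u′ r f) (length ds * suc (k + k))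
                 (store (word zs) v c a (tokens (horner x ds)) [] u u′ r f)
  readBits-run x [] zs h≤k = stop (isBit-word zs)
  readBits-run {v} {c} {a} {u} {u′} {r} {f} {k} x (d ∷ ds) zs h≤k =
    loop refl
      (relax (+-mono-≤ x≤k (≤-trans (≤-reflexive (+-identityʳ _)) 2x≤k))
        (double-run x 0 ⨾
         recast (cong (λ q → store _ v c a q [] u u′ r f) doubled) (transfer-run (λ ()) (tokens (x * 2 + 0)) refl) ⨾
         addDigit d ⨾ pop refl))
      (readBits-run (toℕ d + x * 2) ds zs h≤k)
    where
    2x≤k′ : x * 2 ≤ k
    2x≤k′ = ≤-trans (m≤n+m (x * 2) (toℕ d)) (≤-trans (x≤horner _ ds) h≤k)
    2x≤k : length (tokens (x * 2 + 0)) ≤ k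
    2x≤k = ≤-trans (≤-reflexive (trans (length-tokens (x * 2 + 0)) (+-identityʳ (x * 2)))) 2x≤k′
    x≤k : x ≤ k
    x≤k = ≤-trans (m≤m*n x 2) 2x≤k′
    doubled : tokens (x * 2 + 0) ʳ++ [] ≡ tokens (x * 2)
    doubled = trans (tokens-ʳ++ (x * 2 + 0) 0) (cong tokens (trans (+-identityʳ _) (+-identityʳ _)))
    addDigit : ∀ d {w} → Run (ifTop work isOne (push quota token) skip)
      (store (bit d ∷ w) v c a (tokens (x * 2)) [] u u′ r f) 0
      (store (bit d ∷ w) v c a (tokens (toℕ d + x * 2)) [] u u′ r f)
    addDigit zero       = else refl skip
    addDigit (suc zero) = then refl push

  -- The extra token makes the initial bound one more than the number of cells, hence larger than
  -- any weight: the first candidate is sure to improve on it.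
  measure setup finish : P
  measure = whileTop work is-just (copy work cur ⨾ push bound token ⨾ pop work)
  setup   = measure ⨾ push bound token ⨾ transfer cur work ⨾ push work token
  finish  = transfer best aux ⨾ transfer aux work

  measure-run : ∀ {v c a q q′ u′ r f} xs y →
    Run measure (store xs v c a q q′ (tokens y) u′ r f) (length xs)
                (store [] v (xs ʳ++ c) a q q′ (tokens (length xs + y)) u′ r f)
  measure-run []       y = stop refl
  measure-run {v} {c} {a} {q} {q′} {u′} {r} {f} (x ∷ xs) y =
    recast (cong (λ e → store [] v (xs ʳ++ (x ∷ c)) a q q′ (tokens e) u′ r f) (+-suc (length xs) y))
      (loop refl (copy (λ ()) refl ⨾ push ⨾ pop refl) (measure-run xs (suc y)))

  setup-run : ∀ {n q} (T : Rows n) →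
    Run setup (store (code T) [] [] [] q [] [] [] [] []) (n * suc m + n * suc m)
              (store (worklist (T ∷ [])) [] [] [] q [] (tokens (suc (n * suc m))) [] [] [])
  setup-run {n} {q} T =
    recast (cong₂ (λ w x → store (token ∷ w) [] [] [] q [] (tokens (suc x)) [] [] [])
             (ʳ++-ʳ++ (code T)) (trans (+-identityʳ _) (length-code T)))
      (relax (≤-reflexive (cong₂ _+_ (length-code T) (trans (+-identityʳ _) (length-code-ʳ++ T))))
        (measure-run (code T) 0 ⨾ push ⨾ transfer-run (λ ()) (code T ʳ++ []) refl ⨾ push))

  finish-run : ∀ {n q u} (T : Rows n) →
    Run finish (store [] [] [] [] q [] u [] (code T) []) (n * suc m + n * suc m)
               (store (code T) [] [] [] q [] u [] [] [])
  finish-run {n} {q} {u} T =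
    recast (cong (λ w → store w [] [] [] q [] u [] [] [])
             (trans (ʳ++-ʳ++ (code T)) (++-identityʳ (code T))))
      (relax (≤-reflexive (cong₂ _+_ (length-code T) (length-code-ʳ++ T)))
        (transfer-run (λ ()) (code T) refl ⨾ transfer-run (λ ()) (code T ʳ++ []) refl))

  expandAll : List (Row × Row) → P
  expandAll []             = skip
  expandAll ((a , b) ∷ os) = expand a b ⨾ expandAll os

  expandAllList : ∀ {n} → List (Row × Row) → List (Rows n) → List (Rows n)
  expandAllList []             Ts = Ts
  expandAllList ((a , b) ∷ os) Ts = expandAllList os (expandList a b Ts)

  -- The size is `M` times a power of `suc n` whose exponent is the number of pairs, which depends
  -- on `m` and `s` alone.
  expandAllSize expandAllTicks : {B : Set} → List B → ℕ → ℕ → ℕ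
  expandAllSize  []       n M = M
  expandAllSize  (_ ∷ os) n M = expandAllSize os n (suc n * M)
  expandAllTicks []       n M = 0
  expandAllTicks (_ ∷ os) n M = expandListTicks n M + expandAllTicks os n (suc n * M)

  expandAll-run : ∀ {n q u u′ r M} os (Ts : List (Rows n)) → length Ts ≤ M →
    Run (expandAll os) (store (worklist Ts) [] [] [] q [] u u′ r []) (expandAllTicks os n M)
                       (store (worklist (expandAllList os Ts)) [] [] [] q [] u u′ r [])
  expandAll-run []             Ts Ts≤ = skip
  expandAll-run ((a , b) ∷ os) Ts Ts≤ =
    expand-run a b Ts Ts≤ ⨾ expandAll-run os (expandList a b Ts) (length-expandList a b Ts Ts≤)

  length-expandAllList : ∀ {n M} os (Ts : List (Rows n)) → length Ts ≤ M →
    length (expandAllList os Ts) ≤ expandAllSize os n M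
  length-expandAllList []             Ts Ts≤ = Ts≤
  length-expandAllList ((a , b) ∷ os) Ts Ts≤ =
    length-expandAllList os (expandList a b Ts) (length-expandList a b Ts Ts≤)

  checkAll : List Row → P
  checkAll []       = skip
  checkAll (o ∷ os) = check o ⨾ checkAll os

  checkAllList : ∀ {n} → ℕ → List Row → List (Rows n) → List (Rows n)
  checkAllList k []       Ts = Ts
  checkAllList k (o ∷ os) Ts = checkAllList k os (checkList o k Ts)

  checkAllTicks : {B : Set} → List B → ℕ → ℕ → ℕ → ℕ
  checkAllTicks []       n k M = 0
  checkAllTicks (_ ∷ os) n k M = checkListTicks n k M + checkAllTicks os n k M

  checkAll-run : ∀ {n k u u′ r M} → 1 ≤ k → ∀ os (Ts : List (Rows n)) → length Ts ≤ M →
    Run (checkAll os) (store (worklist Ts) [] [] [] (tokens k) [] u u′ r []) (checkAllTicks os n k M)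
                      (store (worklist (checkAllList k os Ts)) [] [] [] (tokens k) [] u u′ r [])
  checkAll-run 1≤k []       Ts Ts≤ = skip
  checkAll-run {k = k} 1≤k (o ∷ os) Ts Ts≤ =
    check-run o 1≤k Ts Ts≤ ⨾ checkAll-run 1≤k os (checkList o k Ts) (length-checkList o k Ts Ts≤)

  length-checkAllList : ∀ {n M} k os (Ts : List (Rows n)) → length Ts ≤ M →
    length (checkAllList k os Ts) ≤ M
  length-checkAllList k []       Ts Ts≤ = Ts≤
  length-checkAllList k (o ∷ os) Ts Ts≤ =
    length-checkAllList k os (checkList o k Ts) (length-checkList o k Ts Ts≤)

  weight≤ : ∀ {n} (T : Rows n) → weight T ≤ n * suc m
  weight≤ T = ≤-trans (go (toList (Vec.concat T))) (≤-reflexive (length-toList (Vec.concat T)))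
    where
    go : ∀ zs → stars zs ≤ length zs
    go []             = z≤n
    go (nothing ∷ zs) = s≤s (go zs)
    go (just _ ∷ zs)  = ≤-trans (go zs) (n≤1+n _)

  module _ (steps : List (Row × Row)) (outcomes : List Row) where

    solve : P
    solve = readBits ⨾ setup ⨾ expandAll steps ⨾ checkAll outcomes ⨾ minimize ⨾ finish

    candidates : ∀ {n} → ℕ → Rows n → List (Rows n)
    candidates k T = checkAllList k outcomes (expandAllList steps (T ∷ []))

    solveTicks : ℕ → ℕ → ℕ → ℕ
    solveTicks n k b =
      b * suc (k + k) + (ℓ + ℓ + (expandAllTicks steps n 1 + (checkAllTicks outcomes n k M +
        (M * suc (weighTicks n (suc ℓ)) + (ℓ + ℓ)))))
      where
      ℓ = n * suc m
      M = expandAllSize steps n 1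

    SolvedBy : ∀ {n} → ℕ → List (Fin 2) → Rows n → Rows n → Set
    SolvedBy {n} k ds T V =
      V ∈ candidates k T × (∀ {U} → U ∈ candidates k T → weight V ≤ weight U) ×
      ∃[ S ] Run solve (input (List.map bit ds ++ code T)) (solveTicks n k (length ds)) (code V ∷ S)

    solve-run : ∀ {n k} ds (T : Rows n) {V₀} → 1 ≤ k → horner 0 ds ≡ k → V₀ ∈ candidates k T →
      ∃[ V ] SolvedBy k ds T V
    solve-run {n} {k} ds T {V₀} 1≤k refl V₀∈ = result Minimum.origin
      where
      C = candidates k T
      M = expandAllSize steps n 1
      C≤ : length C ≤ M
      C≤ = length-checkAllList k outcomes (expandAllList steps (T ∷ []))
             (length-expandAllList steps (T ∷ []) ≤-refl)
      module Minimum = Minimized (minimize-run {q = tokens k} {q′ = []} {X = suc (n * suc m)}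
                                   C (suc (n * suc m)) [] ≤-refl z≤n)
      result : (Minimum.x′ ≡ suc (n * suc m) × Minimum.r′ ≡ []) ⊎
               (∃[ V ] (V ∈ C × Minimum.x′ ≡ weight V × Minimum.r′ ≡ code V)) → ∃[ V ] SolvedBy k ds T V
      -- The candidate `V₀` weighs less than the initial bound, so the bound cannot have survived.
      result (inj₁ (x≡ , _)) =
        contradiction (≤-trans (≤-trans (≤-reflexive (sym x≡)) (Minimum.minimal V₀∈)) (weight≤ V₀)) 1+n≰n
      result (inj₂ (V , V∈ , x≡ , r≡)) =
        V , V∈ , (λ U∈ → ≤-trans (≤-reflexive (sym x≡)) (Minimum.minimal U∈)) , _ ,
        (readBits-run 0 ds (toList (Vec.concat T)) ≤-refl ⨾
         setup-run T ⨾
         expandAll-run steps (T ∷ []) ≤-refl ⨾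
         checkAll-run 1≤k outcomes (expandAllList steps (T ∷ []))
           (length-expandAllList steps (T ∷ []) ≤-refl) ⨾
         relax (*-monoˡ-≤ (suc (weighTicks n (suc (n * suc m)))) C≤)
           (recast (cong (λ r → store [] [] [] [] (tokens k) [] (tokens Minimum.x′) [] r []) r≡) Minimum.run) ⨾
         finish-run V)

-- Enumeration of the pairs to process and of the rows to count

vectors : {X : Set} → List X → (k : ℕ) → List (Vec X k)
vectors xs zero    = [] ∷ []
vectors xs (suc k) = List.cartesianProductWith _∷_ xs (vectors xs k)

∈-vectors : ∀ {X : Set} {xs : List X} → (∀ x → x ∈ xs) → ∀ {k} (v : Vec X k) → v ∈ vectors xs k
∈-vectors complete []      = here refl
∈-vectors complete (x ∷ v) = ∈-cartesianProductWith⁺ _∷_ (complete x) (∈-vectors complete v)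

module Candidates (m s : ℕ) where
  open Tables m s

  -- A pair of a row and a suppression pattern, zipped column by column so that `vectors` enumerates
  -- the pairs.
  Choice : Set
  Choice = Vec (Fin s × Side) (suc m)

  plain out : ∀ {k} → Vec (Fin s × Side) k → Vec (Maybe (Fin s)) k
  plain = Vec.map (just ∘ proj₁)
  out   = Vec.map (λ { (x , z) → suppressCell z x })

  choices : List Choice
  choices = vectors (List.cartesianProduct (List.allFin s) (inside ∷ outside ∷ [])) (suc m)

  ∈-choices : ∀ q → q ∈ choices
  ∈-choices = ∈-vectors λ { (x , z) → ∈-cartesianProduct⁺ (∈-allFin x) (∈-sides z) }
    where
    ∈-sides : ∀ z → z ∈ (inside ∷ outside ∷ [])
    ∈-sides inside  = here refl
    ∈-sides outside = there (here refl)

  replacement : Choice → Row × Row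
  replacement q = plain q , out q

  outcomes : List Row
  outcomes = vectors (nothing ∷ List.map just (List.allFin s)) (suc m)

  ∈-outcomes : ∀ o → o ∈ outcomes
  ∈-outcomes = ∈-vectors λ { nothing → here refl ; (just x) → there (∈-map⁺ just (∈-allFin x)) }

  -- Soundness of the candidates

  module _ {n} (Q : Rows n → Set) where

    variants-all : ∀ {a b} → (∀ {T} → Q T → Q (replaceFirst a b T)) →
      ∀ c {T acc} → Q T → All Q acc → All Q (variants a b c T acc)
    variants-all stable zero    qT qs = qT ∷ qs
    variants-all stable (suc c) qT qs = variants-all stable c (stable qT) (qT ∷ qs)

    expandList-all : ∀ a b → (∀ {T} → Q T → Q (replaceFirst a b T)) →
      ∀ {Ts} → All Q Ts → All Q (expandList a b Ts)
    expandList-all a b stable qs with a ≟ᵣ b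
    ... | yes _ = qs
    ... | no _  = go qs []
      where
      go : ∀ {Ts acc} → All Q Ts → All Q acc →
        All Q (List.foldl (λ acc T → variants a b (occurrences a T) T acc) acc Ts)
      go []                 qacc = qacc
      go (_∷_ {x = T} q qs) qacc = go qs (variants-all stable (occurrences a T) q qacc)

    -- Replacing first occurrences is the only operation applied to tables, so an invariant of it
    -- passes from the plain table to every candidate.
    expandAllList-all : ∀ qs → (∀ q {T} → Q T → Q (replaceFirst (plain q) (out q) T)) →
      ∀ {Ts} → All Q Ts → All Q (expandAllList (List.map replacement qs) Ts)
    expandAllList-all []       stable all = all
    expandAllList-all (q ∷ qs) stable all =
      expandAllList-all qs stable (expandList-all (plain q) (out q) (stable q) all)

  hide : ∀ {k} → Subset k → Vec (Fin s) k → Vec (Maybe (Fin s)) k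
  hide = Vec.zipWith suppressCell

  hide-plain : ∀ {k} S t (q : Vec (Fin s × Side) k) → hide S t ≡ plain q → t ≡ Vec.map proj₁ q
  hide-plain []            []       []            eq = refl
  hide-plain (outside ∷ S) (x ∷ t) ((y , z) ∷ q) eq =
    cong₂ _∷_ (Maybe.just-injective (Vec.∷-injectiveˡ eq)) (hide-plain S t q (Vec.∷-injectiveʳ eq))
  hide-plain (inside ∷ S)  (x ∷ t) ((y , z) ∷ q) eq with () ← Vec.∷-injectiveˡ eq

  hide-out : ∀ {k} (q : Vec (Fin s × Side) k) → hide (Vec.map proj₂ q) (Vec.map proj₁ q) ≡ out q
  hide-out []            = refl
  hide-out ((x , z) ∷ q) = cong (_ ∷_) (hide-out q)

  out-zip : ∀ {k} (t : Vec (Fin s) k) S → out (Vec.zip t S) ≡ hide S t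
  out-zip []      []      = refl
  out-zip (x ∷ t) (z ∷ S) = cong (_ ∷_) (out-zip t S)

  plain-zip : ∀ {k} (t : Vec (Fin s) k) (S : Subset k) → plain (Vec.zip t S) ≡ Vec.map just t
  plain-zip []      []      = refl
  plain-zip (x ∷ t) (z ∷ S) = cong (_ ∷_) (plain-zip t S)

  Original : ℕ → Set
  Original n = Table (Fin s) n (suc m)

  unsuppressed : ∀ {n} → Original n → Rows n
  unsuppressed = Vec.map (Vec.map just)

  IsSuppression : ∀ {n} → Original n → Rows n → Set
  IsSuppression T V = ∃[ σ ] V ≡ suppress σ T

  unsuppressed-isSuppression : ∀ {n} (T : Original n) → IsSuppression T (unsuppressed T)
  unsuppressed-isSuppression []      = [] , refl
  unsuppressed-isSuppression (t ∷ T) with σ , eq ← unsuppressed-isSuppression T =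
    Vec.replicate _ outside ∷ σ , cong₂ _∷_ (row t) eq
    where
    row : ∀ {k} (t : Vec (Fin s) k) → Vec.map just t ≡ hide (Vec.replicate k outside) t
    row []      = refl
    row (x ∷ t) = cong (_ ∷_) (row t)

  -- A row that matches `plain q` has no star and hence displays its original, the entries of `q`.
  -- The pattern of `q` can thus take the place of its empty one.
  replaceFirst-isSuppression : ∀ {n} (T : Original n) q {V} → IsSuppression T V →
    IsSuppression T (replaceFirst (plain q) (out q) V)
  replaceFirst-isSuppression []      q ([] , refl)    = [] , refl
  replaceFirst-isSuppression (t ∷ T) q (S ∷ σ , refl) with hide S t ≟ᵣ plain q
  ... | no _ with σ′ , eq ← replaceFirst-isSuppression T q (σ , refl) = S ∷ σ′ , cong (_ ∷_) eq
  ... | yes eq with refl ← hide-plain S t q eq =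
    Vec.map proj₂ q ∷ σ , cong (_∷ suppress σ T) (sym (hide-out q))

  -- Anonymity in terms of occurrence numbers

  agreeing : ∀ {n} → Row → Rows n → Subset n
  agreeing o = Vec.map (λ r → does (r ≟ᵣ o))

  ∣agreeing∣ : ∀ {n} o (V : Rows n) → ∣ agreeing o V ∣ ≡ occurrences o V
  ∣agreeing∣ o []      = refl
  ∣agreeing∣ o (r ∷ V) with r ≟ᵣ o
  ... | yes _ = cong suc (∣agreeing∣ o V)
  ... | no _  = ∣agreeing∣ o V

  ∈-agreeing : ∀ {n} o (V : Rows n) i → lookup V i ≡ o → i Subset.∈ agreeing o V
  ∈-agreeing o (r ∷ V) zero    eq rewrite dec-true (r ≟ᵣ o) eq = Vec.here
  ∈-agreeing o (r ∷ V) (suc i) eq = Vec.there (∈-agreeing o V i eq)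

  agreeing-lookup : ∀ {n} o (V : Rows n) i → i Subset.∈ agreeing o V → lookup V i ≡ o
  agreeing-lookup o (r ∷ V) zero    i∈ with r ≟ᵣ o | i∈
  ... | yes eq | _  = eq
  ... | no _   | ()
  agreeing-lookup o (r ∷ V) (suc i) (Vec.there i∈) = agreeing-lookup o V i i∈

  occurrences⇒index : ∀ {n c} o (V : Rows n) → occurrences o V ≡ suc c → ∃[ i ] lookup V i ≡ o
  occurrences⇒index o (r ∷ V) eq with r ≟ᵣ o
  ... | yes r≡o = zero , r≡o
  ... | no _ with i , i≡ ← occurrences⇒index o V eq = suc i , i≡

  IsAdmissible : ∀ {n} → ℕ → Rows n → Set
  IsAdmissible k V = ∀ o → admissible k (occurrences o V) ≡ true

  anonymous⇒admissible : ∀ {n} k (V : Rows n) → IsAnonymous k V → IsAdmissible k V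
  anonymous⇒admissible k V anonymous o with occurrences o V in eq
  ... | zero  = refl
  ... | suc c with i , i≡ ← occurrences⇒index o V eq
              with S , i∉S , k≤ , same ← anonymous i =
    dec-true (k ≤? suc c) (begin
      k                   ≤⟨ suc-pred-≤ k ⟩
      suc (pred k)        ≤⟨ s≤s k≤ ⟩
      -- The inclusion is strict because `i` agrees with itself but lies outside `S`; this accounts
      -- for the difference between `k - 1` other rows and `k` occurrences.
      suc ∣ S ∣           ≤⟨ p⊂q⇒∣p∣<∣q∣ ((λ {j} j∈ → ∈-agreeing o V j (trans (same j j∈) i≡)) ,
                                          i , ∈-agreeing o V i i≡ , i∉S) ⟩
      ∣ agreeing o V ∣    ≡⟨ ∣agreeing∣ o V ⟩
      occurrences o V     ≡⟨ eq ⟩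
      suc c               ∎)
    where
    open ≤-Reasoning
    suc-pred-≤ : ∀ k → k ≤ suc (pred k)
    suc-pred-≤ zero    = z≤n
    suc-pred-≤ (suc k) = ≤-refl

  ∣remove∣ : ∀ {n} (p : Subset n) i → i Subset.∈ p → suc ∣ p [ i ]≔ outside ∣ ≡ ∣ p ∣
  ∣remove∣ (inside ∷ p)  zero    _              = refl
  ∣remove∣ (inside ∷ p)  (suc i) (Vec.there i∈) = cong suc (∣remove∣ p i i∈)
  ∣remove∣ (outside ∷ p) (suc i) (Vec.there i∈) = ∣remove∣ p i i∈

  ∉-remove : ∀ {n} (p : Subset n) i → i Subset.∉ p [ i ]≔ outside
  ∉-remove (x ∷ p) zero    ()
  ∉-remove (x ∷ p) (suc i) (Vec.there i∈) = ∉-remove p i i∈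

  ∈-remove : ∀ {n} (p : Subset n) i {j} → j Subset.∈ p [ i ]≔ outside → j Subset.∈ p
  ∈-remove (x ∷ p) zero    (Vec.there j∈) = Vec.there j∈
  ∈-remove (x ∷ p) (suc i) Vec.here       = Vec.here
  ∈-remove (x ∷ p) (suc i) (Vec.there j∈) = Vec.there (∈-remove p i j∈)

  admissible⇒≤ : ∀ k c → admissible k (suc c) ≡ true → k ≤ suc c
  admissible⇒≤ k c eq with k ≤? suc c
  ... | yes k≤ = k≤
  ... | no k≰ with () ← trans (sym (dec-false (k ≤? suc c) k≰)) eq

  admissible⇒anonymous : ∀ {n} k (V : Rows n) → IsAdmissible k V → IsAnonymous k V
  admissible⇒anonymous k V adm i =
    -- The largest possible witness: all rows equal to row `i`, except `i` itself.
    p [ i ]≔ outside , ∉-remove p i , enough k (occurrences o V) (adm o) (trans (∣remove∣ p i i∈) (∣agreeing∣ o V)) ,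
    λ j j∈ → agreeing-lookup o V j (∈-remove p i j∈)
    where
    o = lookup V i
    p = agreeing o V
    i∈ = ∈-agreeing o V i refl
    enough : ∀ k c → admissible k c ≡ true → suc ∣ p [ i ]≔ outside ∣ ≡ c → pred k ≤ ∣ p [ i ]≔ outside ∣
    enough k (suc c) adm refl = pred-mono-≤ (admissible⇒≤ k c adm)

  checkList-sound : ∀ {n} o k (Ts : List (Rows n)) {V} → V ∈ checkList o k Ts →
    V ∈ Ts × admissible k (occurrences o V) ≡ true
  checkList-sound o k Ts V∈ with go Ts [] V∈
    where
    go : ∀ Ts acc {V} → V ∈ List.foldl (keep o k) acc Ts →
      V ∈ acc ⊎ (V ∈ Ts × admissible k (occurrences o V) ≡ true)
    go []       acc V∈ = inj₁ V∈
    go (T ∷ Ts) acc V∈ with admissible k (occurrences o T) in eq | go Ts (keep o k acc T) V∈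
    ... | _     | inj₂ (V∈Ts , adm) = inj₂ (there V∈Ts , adm)
    ... | false | inj₁ V∈acc         = inj₁ V∈acc
    ... | true  | inj₁ (here refl)   = inj₂ (here refl , eq)
    ... | true  | inj₁ (there V∈acc) = inj₁ V∈acc
  -- The other alternative would place `V` in the initial accumulator, which is empty.
  ... | inj₂ r = r

  checkList-complete : ∀ {n} o k {Ts : List (Rows n)} {V} → V ∈ Ts →
    admissible k (occurrences o V) ≡ true → V ∈ checkList o k Ts
  checkList-complete {n} o k {Ts} {V} V∈ adm = go Ts [] V∈
    where
    kept : ∀ Ts {acc} → V ∈ acc → V ∈ List.foldl (keep o k) acc Ts
    kept []       V∈ = V∈
    kept (T ∷ Ts) V∈ with admissible k (occurrences o T)
    ... | true  = kept Ts (there V∈)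
    ... | false = kept Ts V∈
    go : ∀ Ts acc → V ∈ Ts → V ∈ List.foldl (keep o k) acc Ts
    go (T ∷ Ts) acc (here refl) rewrite adm = kept Ts (here refl)
    go (T ∷ Ts) acc (there V∈)  = go Ts (keep o k acc T) V∈

  checkAllList-sound : ∀ {n} k os (Ts : List (Rows n)) {V} → V ∈ checkAllList k os Ts →
    V ∈ Ts × (∀ {o} → o ∈ os → admissible k (occurrences o V) ≡ true)
  checkAllList-sound k []       Ts V∈ = V∈ , λ ()
  checkAllList-sound k (o ∷ os) Ts V∈
    with V∈′ , adm ← checkAllList-sound k os (checkList o k Ts) V∈
    with V∈″ , adm₀ ← checkList-sound o k Ts V∈′ =
    V∈″ , λ { (here refl) → adm₀ ; (there o∈) → adm o∈ }

  checkAllList-complete : ∀ {n} k os {Ts : List (Rows n)} {V} → V ∈ Ts → IsAdmissible k V →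
    V ∈ checkAllList k os Ts
  checkAllList-complete k []       V∈ adm = V∈
  checkAllList-complete k (o ∷ os) V∈ adm =
    checkAllList-complete k os (checkList-complete o k V∈ (adm o)) adm

  -- Completeness of the candidates

  -- As the length of a filtered list, the count inherits invariance under permutations.
  occurrences-filter : ∀ {n} o (V : Rows n) → occurrences o V ≡ length (List.filter (_≟ᵣ o) (toList V))
  occurrences-filter o []      = refl
  occurrences-filter o (r ∷ V) with r ≟ᵣ o
  ... | yes _ = cong suc (occurrences-filter o V)
  ... | no _  = occurrences-filter o V

  occurrences-↭ : ∀ {n n′} o {V : Rows n} {U : Rows n′} → toList V ↭ toList U → occurrences o V ≡ occurrences o U
  occurrences-↭ o {V} {U} V↭U =
    trans (occurrences-filter o V)
      (trans (↭-length (filter-↭ (_≟ᵣ o) V↭U)) (sym (occurrences-filter o U)))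

  weight-sum : ∀ {n} (V : Rows n) → weight V ≡ sum (List.map (stars ∘ toList) (toList V))
  weight-sum []      = refl
  weight-sum (r ∷ V) = begin
    stars (toList (r Vec.++ Vec.concat V))             ≡⟨ cong stars (toList-++ r (Vec.concat V)) ⟩
    stars (toList r ++ toList (Vec.concat V))          ≡⟨ stars-++ (toList r) ⟩
    stars (toList r) + weight V                        ≡⟨ cong (stars (toList r) +_) (weight-sum V) ⟩
    stars (toList r) + sum (List.map (stars ∘ toList) (toList V)) ∎
    where
    open ≡-Reasoning
    stars-++ : ∀ xs {ys} → stars (xs ++ ys) ≡ stars xs + stars ys
    stars-++ []             = refl
    stars-++ (nothing ∷ xs) = cong suc (stars-++ xs)
    stars-++ (just _ ∷ xs)  = stars-++ xs

  weight-↭ : ∀ {n n′} {V : Rows n} {U : Rows n′} → toList V ↭ toList U → weight V ≡ weight U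
  weight-↭ {V = V} {U} V↭U =
    trans (weight-sum V) (trans (sum-↭ (map⁺ (stars ∘ toList) V↭U)) (sym (weight-sum U)))

  weight-suppress : ∀ {n} σ (T : Original n) → weight (suppress σ T) ≡ cost σ
  weight-suppress []      []      = refl
  weight-suppress (S ∷ σ) (t ∷ T) = begin
    weight (hide S t ∷ suppress σ T)                 ≡⟨ weight-sum (hide S t ∷ suppress σ T) ⟩
    stars (toList (hide S t)) + _                    ≡⟨ cong₂ _+_ (row S t) (sym (weight-sum (suppress σ T))) ⟩
    ∣ S ∣ + weight (suppress σ T)                    ≡⟨ cong (∣ S ∣ +_) (weight-suppress σ T) ⟩
    ∣ S ∣ + cost σ                                   ∎
    where
    open ≡-Reasoning
    row : ∀ {k} S (t : Vec (Fin s) k) → stars (toList (hide S t)) ≡ ∣ S ∣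
    row []            []      = refl
    row (inside ∷ S)  (x ∷ t) = cong suc (row S t)
    row (outside ∷ S) (x ∷ t) = row S t

  -- Replacement of some rows `a` by `b`, one at a time and up to order, so that it is left open
  -- which of them are chosen. The number of `replace` steps tells which of the `variants` to look
  -- for.
  data Replaces (a b : Row) : List Row → List Row → Set where
    done    : ∀ {U U′} → U ↭ U′ → Replaces a b U U′
    replace : ∀ {U Z U′} → U ↭ a ∷ Z → Replaces a b (b ∷ Z) U′ → Replaces a b U U′

  restart : ∀ {a b U V U′} → V ↭ U → Replaces a b U U′ → Replaces a b V U′
  restart V↭ (done U↭)          = done (↭-trans V↭ U↭)
  restart V↭ (replace U↭ steps) = replace (↭-trans V↭ U↭) steps

  -- In each step `r` trades places with the `a` in front, and with the `b` put in its stead.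
  replaces-∷ : ∀ {a b U U′} r → Replaces a b U U′ → Replaces a b (r ∷ U) (r ∷ U′)
  replaces-∷ r (done U↭)          = done (prep r U↭)
  replaces-∷ r (replace U↭ steps) =
    replace (↭-trans (prep r U↭) (swap r _ ↭-refl)) (restart (swap _ r ↭-refl) (replaces-∷ r steps))

  replaces-refl : ∀ {a U U′} → Replaces a a U U′ → U ↭ U′
  replaces-refl (done U↭)          = U↭
  replaces-refl (replace U↭ steps) = ↭-trans U↭ (replaces-refl steps)

  replaceFirst-↭ : ∀ {n c} a b (V : Rows n) → occurrences a V ≡ suc c →
    ∃[ Y ] (toList V ↭ a ∷ Y × toList (replaceFirst a b V) ↭ b ∷ Y)
  replaceFirst-↭ a b (r ∷ V) eq with r ≟ᵣ a
  ... | yes refl = toList V , ↭-refl , ↭-refl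
  ... | no _ with Y , V↭ , V′↭ ← replaceFirst-↭ a b V eq =
    r ∷ Y , ↭-trans (prep r V↭) (swap r a ↭-refl) , ↭-trans (prep r V′↭) (swap r b ↭-refl)

  occurrences-∷ : ∀ {n} a {Z} (V : Rows n) → toList V ↭ a ∷ Z → ∃[ c ] occurrences a V ≡ suc c
  occurrences-∷ a {Z} V V↭ =
    _ , trans (trans (occurrences-filter a V) (↭-length (filter-↭ (_≟ᵣ a) V↭))) (first Z)
    where
    first : ∀ Z → length (List.filter (_≟ᵣ a) (a ∷ Z)) ≡ suc (length (List.filter (_≟ᵣ a) Z))
    first Z rewrite does-refl a = refl

  variants-⊇ : ∀ {n a b} c T {acc : List (Rows n)} {V} → V ∈ acc → V ∈ variants a b c T acc
  variants-⊇ zero    T V∈ = there V∈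
  variants-⊇ (suc c) T V∈ = variants-⊇ c (replaceFirst _ _ T) (there V∈)

  -- Induction on the replacement steps, in parallel with the rounds. At `done` the table in hand is
  -- the one sought, and it is emitted whether or not further rounds follow.
  variants-complete : ∀ {n a b U U′} → a ≢ b → Replaces a b U U′ → ∀ c (V : Rows n) acc →
    occurrences a V ≡ c → toList V ↭ U → ∃[ V′ ] (V′ ∈ variants a b c V acc × toList V′ ↭ U′)
  variants-complete a≢b (done U↭) zero V acc eq V↭ = V , here refl , ↭-trans V↭ U↭
  variants-complete a≢b (done U↭) (suc c) V acc eq V↭ =
    V , variants-⊇ c (replaceFirst _ _ V) (here refl) , ↭-trans V↭ U↭
  variants-complete {a = a} {b} a≢b (replace U↭ steps) c V acc eq V↭
    -- A step to be made needs an `a` in `V`, so `c` is a successor and another round follows.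
    with c′ , eq′ ← occurrences-∷ a V (↭-trans V↭ U↭)
    with refl ← trans (sym eq) eq′
    with Y , V↭Y , V′↭Y ← replaceFirst-↭ a b V eq =
    variants-complete a≢b steps c′ (replaceFirst a b V) (V ∷ acc) (occurrences-replaceFirst a≢b V eq)
      -- Taking one `a` out of `V` leaves the same rows up to order, whether it is the first `a` or
      -- the one named by the step.
      (↭-trans V′↭Y (prep b (drop-∷ (↭-trans (↭-sym V↭Y) (↭-trans V↭ U↭)))))

  expandList-complete : ∀ {n} a b {Ts : List (Rows n)} {V U′} → V ∈ Ts → Replaces a b (toList V) U′ →
    ∃[ V′ ] (V′ ∈ expandList a b Ts × toList V′ ↭ U′)
  expandList-complete {n} a b {Ts} {V} {U′} V∈ steps with a ≟ᵣ b
  ... | yes refl = V , V∈ , replaces-refl steps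
  ... | no a≢b   = go Ts [] V∈
    where
    expandTo : List (Rows n) → Rows n → List (Rows n)
    expandTo acc T = variants a b (occurrences a T) T acc
    kept : ∀ Ts {acc V′} → V′ ∈ acc → V′ ∈ List.foldl expandTo acc Ts
    kept []       V∈ = V∈
    kept (T ∷ Ts) V∈ = kept Ts (variants-⊇ (occurrences a T) T V∈)
    go : ∀ Ts acc → V ∈ Ts → ∃[ V′ ] (V′ ∈ List.foldl expandTo acc Ts × toList V′ ↭ U′)
    go (T ∷ Ts) acc (here refl)
      with V′ , V′∈ , V′↭ ← variants-complete a≢b steps (occurrences a T) T acc refl ↭-refl =
      V′ , kept Ts V′∈ , V′↭
    go (T ∷ Ts) acc (there V∈) = go Ts (expandTo acc T) V∈

  infix 4 _≟ᶜ_

  _≟ᶜ_ : DecidableEquality Choice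
  _≟ᶜ_ = Vec.≡-dec (Product.≡-dec Fin._≟_ Bool._≟_)

  -- Progress of the expansion: `g l` is the present form of the rows that are to be treated
  -- according to `l`.
  Stage : (Choice → Row) → Set
  Stage g = ∀ l → g l ≡ plain l ⊎ g l ≡ out l

  finalize : (Choice → Row) → Choice → Choice → Row
  finalize g q l = if does (l ≟ᶜ q) then out l else g l

  finalize-stage : ∀ {g} q → Stage g → Stage (finalize g q)
  finalize-stage q stage l with l ≟ᶜ q
  ... | yes _ = inj₂ refl
  ... | no _  = stage l

  finalize-out : ∀ {g} q l → g l ≡ out l → finalize g q l ≡ out l
  finalize-out q l eq with l ≟ᶜ q
  ... | yes _ = refl
  ... | no _  = eq

  finalize-self : ∀ g q → finalize g q q ≡ out q
  finalize-self g q rewrite dec-true (q ≟ᶜ q) refl = refl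

  -- Only the rows assigned to `q` change; other rows that still look like `plain q` may wait for
  -- their own turn, because `Replaces` does not force every copy to be replaced. The case `inj₂` is
  -- that of rows already in their final form.
  finalize-replaces : ∀ {g} q → Stage g → ∀ ls →
    Replaces (plain q) (out q) (List.map g ls) (List.map (finalize g q) ls)
  finalize-replaces q stage [] = done ↭-refl
  finalize-replaces {g} q stage (l ∷ ls) with l ≟ᶜ q | finalize-replaces q stage ls
  ... | no _     | steps = replaces-∷ (g l) steps
  ... | yes refl | steps with stage q
  ...   | inj₂ eq = restart (↭-reflexive (cong (_∷ List.map g ls) eq)) (replaces-∷ (out q) steps)
  ...   | inj₁ eq = replace (↭-reflexive (cong (_∷ List.map g ls) eq)) (replaces-∷ (out q) steps)

  -- The invariant is that every choice is still ahead or already final. It holds initially for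
  -- `plain`, as `choices` is exhaustive, and in the end leaves only final rows.
  expandAllList-complete : ∀ {n} qs {g} ls → Stage g → (∀ q → q ∈ qs ⊎ g q ≡ out q) →
    ∀ {Ts : List (Rows n)} {V} → V ∈ Ts → toList V ↭ List.map g ls →
    ∃[ V′ ] (V′ ∈ expandAllList (List.map replacement qs) Ts × toList V′ ↭ List.map out ls)
  expandAllList-complete [] {g} ls stage finished {V = V} V∈ V↭ =
    V , V∈ , ↭-trans V↭ (↭-reflexive (List.map-cong final ls))
    where
    final : ∀ q → g q ≡ out q
    final q with inj₂ eq ← finished q = eq
  expandAllList-complete (q ∷ qs) {g} ls stage finished V∈ V↭
    with V′ , V′∈ , V′↭ ← expandList-complete (plain q) (out q) V∈ (restart V↭ (finalize-replaces q stage ls)) =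
    expandAllList-complete qs ls (finalize-stage q stage) remaining V′∈ V′↭
    where
    remaining : ∀ l → l ∈ qs ⊎ finalize g q l ≡ out l
    remaining l with finished l
    ... | inj₂ eq          = inj₂ (finalize-out {g} q l eq)
    ... | inj₁ (there l∈)  = inj₁ l∈
    ... | inj₁ (here refl) = inj₂ (finalize-self g q)

  selected : ∀ {n} → Original n → Suppression n (suc m) → List Choice
  selected T τ = toList (Vec.zipWith Vec.zip T τ)

  selected-plain : ∀ {n} (T : Original n) τ → toList (unsuppressed T) ≡ List.map plain (selected T τ)
  selected-plain []      []      = refl
  selected-plain (t ∷ T) (S ∷ τ) = cong₂ _∷_ (sym (plain-zip t S)) (selected-plain T τ)

  selected-out : ∀ {n} (T : Original n) τ → List.map out (selected T τ) ≡ toList (suppress τ T)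
  selected-out []      []      = refl
  selected-out (t ∷ T) (S ∷ τ) = cong₂ _∷_ (out-zip t S) (selected-out T τ)

  steps : List (Row × Row)
  steps = List.map replacement choices

  candidate-sound : ∀ {n} k (T : Original n) {V} → V ∈ candidates steps outcomes k (unsuppressed T) →
    ∃[ σ ] (V ≡ suppress σ T × IsFeasible k T σ)
  candidate-sound k T {V} V∈
    with V∈′ , adm ← checkAllList-sound k outcomes (expandAllList steps (unsuppressed T ∷ [])) V∈
    with σ , refl ← All.lookup (expandAllList-all (IsSuppression T) choices (replaceFirst-isSuppression T)
                      (unsuppressed-isSuppression T ∷ [])) V∈′ =
    σ , refl , admissible⇒anonymous k V (λ o → adm (∈-outcomes o))

  candidate-complete : ∀ {n} k (T : Original n) τ → IsFeasible k T τ →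
    ∃[ V ] (V ∈ candidates steps outcomes k (unsuppressed T) × weight V ≡ cost τ)
  candidate-complete k T τ feasible
    with V , V∈ , V↭ ← expandAllList-complete choices (selected T τ) (λ _ → inj₁ refl)
           (λ q → inj₁ (∈-choices q)) (here refl) (↭-reflexive (selected-plain T τ)) =
    V , checkAllList-complete k outcomes V∈ adm ,
    trans (weight-↭ {V = V} {suppress τ T} V↭τ) (weight-suppress τ T)
    where
    V↭τ : toList V ↭ toList (suppress τ T)
    V↭τ = ↭-trans V↭ (↭-reflexive (selected-out T τ))
    adm : IsAdmissible k V
    adm o = trans (cong (admissible k) (occurrences-↭ o {V} {suppress τ T} V↭τ))
              (anonymous⇒admissible k (suppress τ T) feasible o)

-- Polynomial bounds

module PolynomialBounds {X : Set} (measure : X → ℕ) where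

  -- The base is the successor of the measure so that sums and products of
  -- bounds are bounds also where the measure vanishes.
  Bounded : (X → ℕ) → Set
  Bounded f = ∃[ c ] ∃[ d ] (∀ x → f x ≤ c * suc (measure x) ^ d)

  bounded-const : ∀ c → Bounded (λ _ → c)
  bounded-const c = c , 0 , λ x → ≤-reflexive (sym (*-identityʳ c))

  bounded-measure : ∀ {f} → (∀ x → f x ≤ measure x) → Bounded f
  bounded-measure f≤ = 1 , 1 , λ x → ≤-trans (f≤ x) (≤-trans (n≤1+n _)
    (≤-reflexive (sym (trans (*-identityˡ _) (*-identityʳ _)))))

  infixl 6 _⊕_
  infixl 7 _⊗_

  _⊕_ : ∀ {f g} → Bounded f → Bounded g → Bounded (λ x → f x + g x)
  (c , d , f≤) ⊕ (c′ , d′ , g≤) = c + c′ , d + d′ , λ x → let N = suc (measure x) in begin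
    _                                     ≤⟨ +-mono-≤ (f≤ x) (g≤ x) ⟩
    c * N ^ d + c′ * N ^ d′               ≤⟨ +-mono-≤ (*-monoʳ-≤ c (^-monoʳ-≤ N (m≤m+n d d′)))
                                                      (*-monoʳ-≤ c′ (^-monoʳ-≤ N (m≤n+m d′ d))) ⟩
    c * N ^ (d + d′) + c′ * N ^ (d + d′)  ≡⟨ *-distribʳ-+ (N ^ (d + d′)) c c′ ⟨
    (c + c′) * N ^ (d + d′)               ∎
    where open ≤-Reasoning

  _⊗_ : ∀ {f g} → Bounded f → Bounded g → Bounded (λ x → f x * g x)
  (c , d , f≤) ⊗ (c′ , d′ , g≤) = c * c′ , d + d′ , λ x → let N = suc (measure x) in begin
    _                              ≤⟨ *-mono-≤ (f≤ x) (g≤ x) ⟩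
    (c * N ^ d) * (c′ * N ^ d′)    ≡⟨ [m*n]*[o*p]≡[m*o]*[n*p] c (N ^ d) c′ (N ^ d′) ⟩
    (c * c′) * (N ^ d * N ^ d′)    ≡⟨ cong (c * c′ *_) (^-distribˡ-+-* N d d′) ⟨
    (c * c′) * N ^ (d + d′)        ∎
    where open ≤-Reasoning

  bounded-suc : ∀ {f} → Bounded f → Bounded (λ x → suc (f x))
  bounded-suc f≤ = bounded-const 1 ⊕ f≤

  ^-distribʳ-* : ∀ a b d → (a * b) ^ d ≡ a ^ d * b ^ d
  ^-distribʳ-* a b zero    = refl
  ^-distribʳ-* a b (suc d) =
    trans (cong (a * b *_) (^-distribʳ-* a b d)) ([m*n]*[o*p]≡[m*o]*[n*p] a b (a ^ d) (b ^ d))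

  -- For positive `n` the successor is at most twice `n`; the summand 1 takes care of `n = 0`.
  suc^≤ : ∀ n d → suc n ^ d ≤ 2 ^ d * n ^ d + 1
  suc^≤ zero    d = ≤-trans (≤-reflexive (^-zeroˡ d)) (m≤n+m 1 _)
  suc^≤ (suc n) d = begin
    (2 + n) ^ d              ≤⟨ ^-monoˡ-≤ d (s≤s (≤-trans (m≤n+m (suc n) n)
                                  (+-monoʳ-≤ n (≤-reflexive (sym (+-identityʳ (suc n))))))) ⟩
    (2 * suc n) ^ d          ≡⟨ ^-distribʳ-* 2 (suc n) d ⟩
    2 ^ d * suc n ^ d        ≤⟨ m≤m+n _ 1 ⟩
    2 ^ d * suc n ^ d + 1    ∎
    where open ≤-Reasoning

  -- One constant must serve as factor and as summand, so the summand `c` is enlarged to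
  -- `c * 2 ^ d`.
  bounded⇒polynomial : ∀ {f} → Bounded f → ∃[ c ] ∃[ d ] (∀ x → f x ≤ c * measure x ^ d + c)
  bounded⇒polynomial {f} (c , d , f≤) = c * 2 ^ d , d , λ x → let n = measure x in begin
    f x                                ≤⟨ f≤ x ⟩
    c * suc n ^ d                      ≤⟨ *-monoʳ-≤ c (suc^≤ n d) ⟩
    c * (2 ^ d * n ^ d + 1)            ≡⟨ *-distribˡ-+ c (2 ^ d * n ^ d) 1 ⟩
    c * (2 ^ d * n ^ d) + c * 1        ≡⟨ cong (_+ c * 1) (*-assoc c (2 ^ d) (n ^ d)) ⟨
    c * 2 ^ d * n ^ d + c * 1          ≤⟨ +-monoʳ-≤ (c * 2 ^ d * n ^ d) (*-monoʳ-≤ c (m^n>0 2 d)) ⟩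
    c * 2 ^ d * n ^ d + c * 2 ^ d      ∎
    where open ≤-Reasoning

-- From stack programs to polynomial-time solvability

module _ {A : Set} (problem : SearchProblem A) where
  open SearchProblem problem
  open PolynomialBounds (λ x → length (encodeInstance x))

  stack-solvable : ∀ {n ticks} (p : Program A (suc n)) → Bounded ticks →
    (∀ x → ∃[ y ] (IsCorrect x y × ∃[ S ]
       Run p (input (encodeInstance x)) (ticks x) (encodeSolution x y ∷ S))) →
    PolynomialTimeSolvable problem
  stack-solvable {ticks = ticks} p ticks≤ runs
    with c , d , bound ← bounded⇒polynomial (bounded-suc ticks≤ ⊗ bounded-const (size p)) =
    machine p , c , d , λ x →
      let y , correct , S , run = runs x
          t , final , halts , t≤ , out≡ = machine-computes p run
      in y , correct , t , final , halts , ≤-trans t≤ (bound x) , out≡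

-- Anonymization of tables with at least one column

module _ (m s : ℕ) where
  open Tables m s
  open Candidates m s
  open AnonymizationInstance

  encode : AnonymizationInstance (suc m) s → List (Letter s)
  encode = SearchProblem.encodeInstance (kAnonymization (suc m) s)

  bits : AnonymizationInstance (suc m) s → List (Fin 2)
  bits x = List.reverse (proj₁ (toDigits 2 (privacy x)))

  encodeTable-entry : ∀ {n} (T : Original n) → encodeTable entry T ≡ code (unsuppressed T)
  encodeTable-entry T = begin
    List.map entry (toList (Vec.concat T))                            ≡⟨ List.map-∘ (toList (Vec.concat T)) ⟩
    List.map encodeMaybe (List.map just (toList (Vec.concat T)))      ≡⟨ cong word (Vec.toList-map just (Vec.concat T)) ⟨
    List.map encodeMaybe (toList (Vec.map just (Vec.concat T)))       ≡⟨ cong (word ∘ toList) (Vec.map-concat just T) ⟩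
    code (unsuppressed T)                                             ∎
    where open ≡-Reasoning

  encode-≡ : ∀ x → encode x ≡ List.map bit (bits x) ++ code (unsuppressed (table x))
  encode-≡ x = cong (encodeBinary (privacy x) ++_) (encodeTable-entry (table x))

  length-encode : ∀ x → length (encode x) ≡ length (bits x) + rows x * suc m
  length-encode x = begin
    length (encode x)                                             ≡⟨ cong length (encode-≡ x) ⟩
    length (List.map bit (bits x) ++ code (unsuppressed (table x)))  ≡⟨ length-++ (List.map bit (bits x)) ⟩
    length (List.map bit (bits x)) + length (code (unsuppressed (table x)))
      ≡⟨ cong₂ _+_ (length-map bit (bits x)) (length-code (unsuppressed (table x))) ⟩
    length (bits x) + rows x * suc m                              ∎
    where open ≡-Reasoning

  open PolynomialBounds (λ x → length (encode x))

  bounded-bits : Bounded (λ x → length (bits x))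
  bounded-bits = bounded-measure λ x → ≤-trans (m≤m+n _ _) (≤-reflexive (sym (length-encode x)))

  -- Every row contributes `suc m` letters, hence at least one, to the input.
  rows≤ : ∀ x → rows x ≤ length (encode x)
  rows≤ x = ≤-trans (m≤m*n (rows x) (suc m)) (≤-trans (m≤n+m _ _) (≤-reflexive (sym (length-encode x))))

  bounded-rows : Bounded rows
  bounded-rows = bounded-measure rows≤

  -- The binary code of `k` alone would allow a value exponential in its length; it is the
  -- comparison with the number of rows that bounds it.
  bounded-privacy : Bounded privacy
  bounded-privacy = bounded-measure λ x → ≤-trans (privacy≤rows x) (rows≤ x)

  bounded-cells : Bounded (λ x → rows x * suc m)
  bounded-cells = bounded-rows ⊗ bounded-const (suc m)

  -- The degree grows with the list, but the list is the same for all instances.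
  bounded-expandAllSize : ∀ {B : Set} (os : List B) {M} → Bounded M → Bounded (λ x → expandAllSize os (rows x) (M x))
  bounded-expandAllSize []       M≤ = M≤
  bounded-expandAllSize (_ ∷ os) M≤ = bounded-expandAllSize os (bounded-suc bounded-rows ⊗ M≤)

  bounded-expandAllTicks : ∀ {B : Set} (os : List B) {M} → Bounded M → Bounded (λ x → expandAllTicks os (rows x) (M x))
  bounded-expandAllTicks []       M≤ = bounded-const 0
  bounded-expandAllTicks (_ ∷ os) {M} M≤ =
    -- The expression `expandListTicks`, unfolded down to `roundTicks`, summand by summand.
    (M≤ ⊗ bounded-suc (ℓ ⊕ n⁺ ⊗ bounded-suc (ℓ ⊕ (bounded-rows ⊕ ℓ))) ⊕ (n⁺ ⊗ M≤ ⊕ n⁺ ⊗ M≤) ⊗ bounded-suc ℓ)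
      ⊕ bounded-expandAllTicks os (n⁺ ⊗ M≤)
    where
    ℓ  = bounded-cells
    n⁺ = bounded-suc bounded-rows

  bounded-checkAllTicks : ∀ {B : Set} (os : List B) {M} → Bounded M →
    Bounded (λ x → checkAllTicks os (rows x) (privacy x) (M x))
  bounded-checkAllTicks []       M≤ = bounded-const 0
  bounded-checkAllTicks (_ ∷ os) M≤ =
    (M≤ ⊗ bounded-suc (bounded-rows ⊕ (bounded-cells ⊕ bounded-privacy)) ⊕ (M≤ ⊕ M≤) ⊗ bounded-suc bounded-cells)
      ⊕ bounded-checkAllTicks os M≤

  program : P
  program = solve steps outcomes

  ticks : AnonymizationInstance (suc m) s → ℕ
  ticks x = solveTicks steps outcomes (rows x) (privacy x) (length (bits x))

  bounded-ticks : Bounded ticks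
  bounded-ticks =
    bounded-bits ⊗ bounded-suc (bounded-privacy ⊕ bounded-privacy) ⊕ (ℓ ⊕ ℓ ⊕
      (bounded-expandAllTicks steps (bounded-const 1) ⊕ (bounded-checkAllTicks outcomes M ⊕
        (M ⊗ bounded-suc (ℓ ⊕ (bounded-suc ℓ ⊕ (bounded-suc ℓ ⊕ (ℓ ⊕ ℓ)))) ⊕ (ℓ ⊕ ℓ)))))
    where
    ℓ = bounded-cells
    M = bounded-expandAllSize steps (bounded-const 1)

  everything : ∀ n → Suppression n (suc m)
  everything n = Vec.replicate n (Vec.replicate (suc m) inside)

  -- By completeness this supplies the candidate whose existence `solve-run` requires.
  everything-feasible : ∀ {n} k (T : Original n) → k ≤ n → IsFeasible k T (everything n)
  everything-feasible {n} k T k≤n i = p , ∉-remove Subset.⊤ i , enough ,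
    λ j _ → trans (lookup-stars j) (sym (lookup-stars i))
    where
    p = Subset.⊤ [ i ]≔ outside
    enough : pred k ≤ ∣ p ∣
    enough = pred-mono-≤ (≤-trans k≤n (≤-reflexive (sym (trans (∣remove∣ Subset.⊤ i ∈⊤) (∣⊤∣≡n n)))))
    hidden : ∀ {l} (t : Vec (Fin s) l) → hide (Vec.replicate l inside) t ≡ Vec.replicate l nothing
    hidden []      = refl
    hidden (x ∷ t) = cong (nothing ∷_) (hidden t)
    lookup-stars : ∀ j → lookup (suppress (everything n) T) j ≡ Vec.replicate (suc m) nothing
    lookup-stars j = begin
      lookup (suppress (everything n) T) j          ≡⟨ Vec.lookup-zipWith hide j (everything n) T ⟩
      hide (lookup (everything n) j) (lookup T j)   ≡⟨ cong (λ S → hide S (lookup T j)) (Vec.lookup-replicate j _) ⟩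
      hide (Vec.replicate (suc m) inside) (lookup T j)  ≡⟨ hidden (lookup T j) ⟩
      Vec.replicate (suc m) nothing                 ∎
      where open ≡-Reasoning

  optimal-run : ∀ x → ∃[ σ ] (IsOptimal (privacy x) (table x) σ × ∃[ S ]
    Run program (input (encode x)) (ticks x) (encodeTable encodeMaybe (suppress σ (table x)) ∷ S))
  optimal-run x = found (solve-run steps outcomes (bits x) T (privacy≥1 x) value
      (proj₁ (proj₂ (candidate-complete k (table x) (everything (rows x))
        (everything-feasible k (table x) (privacy≤rows x))))))
    where
    k = privacy x
    T = unsuppressed (table x)
    value : horner 0 (bits x) ≡ k
    value = trans (horner-reverse (proj₁ (toDigits 2 k))) (proj₂ (toDigits 2 k))
    found : ∃[ V ] SolvedBy steps outcomes k (bits x) T V → _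
    found (V , V∈ , minimal , S , run) = suppressed (candidate-sound k (table x) V∈)
      where
      suppressed : ∃[ σ ] (V ≡ suppress σ (table x) × IsFeasible k (table x) σ) → _
      suppressed (σ , V≡ , feasible) = σ , (feasible , optimal) , S ,
        subst₂ (λ u v → Run program (input u) (ticks x) (v ∷ S))
          (sym (encode-≡ x)) (cong code V≡) run
        where
        optimal : ∀ τ → IsFeasible k (table x) τ → cost σ ≤ cost τ
        optimal τ τ-feasible = below (candidate-complete k (table x) τ τ-feasible)
          where
          open ≤-Reasoning
          below : ∃[ U ] (U ∈ candidates steps outcomes k T × weight U ≡ cost τ) → cost σ ≤ cost τ
          below (U , U∈ , weight≡) = begin
            cost σ                        ≡⟨ weight-suppress σ (table x) ⟨
            weight (suppress σ (table x)) ≡⟨ cong weight V≡ ⟨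
            weight V                      ≤⟨ minimal U∈ ⟩
            weight U                      ≡⟨ weight≡ ⟩
            cost τ                        ∎

  solvable : PolynomialTimeSolvable (kAnonymization (suc m) s)
  solvable = stack-solvable (kAnonymization (suc m) s) program bounded-ticks optimal-run

mainTheorem4 : (m s : ℕ) → .{{NonZero m}} → .{{NonZero s}} → PolynomialTimeSolvable (kAnonymization m s)
mainTheorem4 zero    s {{m≢0}} = contradiction refl (≢-nonZero⁻¹ 0 {{m≢0}})
mainTheorem4 (suc m) s         = solvable m s
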